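{- Let $n\ge0$ and let $(\gamma_\alpha)_{\alpha}$ be a family of nonnegative real numbers indexed by the compositions $\alpha$ of $n$. Let $\mathbb{k}$ be an ordered commutative ring containing the numbers $\gamma_\alpha$ (e.g. $\mathbb{k}=\mathbb{R}$). Put $B_\gamma=\sum_\alpha\gamma_\alpha B_\alpha\in\mathbb{k}S_n$ and, for $F\in\Sigma_n$, $\widetilde{n}_\gamma(F)=\sum_\alpha\gamma_\alpha\widetilde{n}_\alpha(F)\in\mathbb{k}$, and $\widetilde{n}_\gamma(\Sigma_n)=\{\widetilde{n}_\gamma(F):F\in\Sigma_n\}$. Then \[ \prod_{k\in\widetilde{n}_\gamma(\Sigma_n)}(w_0B_\gamma-k)=0\qquad\text{and}\qquad\prod_{k\in\widetilde{n}_\gamma(\Sigma_n)}(B_\gamma w_0-k)=0, \] the products ranging over distinct elements of $\widetilde{n}_\gamma(\Sigma_n)$.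
   Context: $[n]=\{1,\ldots,n\}$; $S_n$ the symmetric group with $(\sigma\tau)(i)=\sigma(\tau(i))$, $\mathbb{k}S_n$ its group algebra, $w_0(i)=n+1-i$. For a composition $\alpha=(\alpha_1,\ldots,\alpha_k)$ of $n$ (positive integers summing to $n$) let $D(\alpha)=\{\alpha_1,\ldots,\alpha_1+\cdots+\alpha_{k-1}\}$ and $B_\alpha=\sum_{w\in S_n:\operatorname{Des}w\subseteq D(\alpha)}w$, where $\operatorname{Des}w=\{i\in[n-1]:w(i)>w(i+1)\}$. A set composition of $[n]$ is a tuple $F=(F_1,\ldots,F_m)$ of nonempty pairwise disjoint sets with union $[n]$; $\ell(F)=m$, $\operatorname{type}F=(|F_1|,\ldots,|F_m|)$; $\Sigma_n$ is the set of all of them. $F\preceq G$ means each block of $F$ lies in some block of $G$. $n_\alpha(F)=\#\{G\in\Sigma_n:F\preceq G,\ \operatorname{type}G=\alpha\}$ and $\widetilde{n}_\alpha(F)=(-1)^{n-\ell(F)}n_\alpha(F)$. -}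

module Defs where

open import Level using (Level; suc; _⊔_)
open import Data.Bool using (Bool; true; false; _∧_; if_then_else_)
open import Data.Nat as ℕ using (ℕ; zero; _∸_; _<ᵇ_; _≡ᵇ_)
open import Data.Fin as Fin using (Fin; toℕ; opposite)
open import Data.Fin.Properties using () renaming (_≟_ to _≟ᶠ_)
open import Data.List as List using (List; []; _∷_; map; concatMap; filter; allFin; upTo; length; foldr)
open import Data.Bool.ListAction using (all; any)
open import Data.Vec as Vec using (Vec; lookup; tabulate)
open import Data.Vec.Properties using (≡-dec)
open import Data.List.Properties using () renaming (≡-dec to ≡-decL)
open import Data.Product using (Σ; _,_; ∃)
open import Relation.Nullary.Decidable using (⌊_⌋)
open import Relation.Binary.Core using (Rel)
open import Relation.Binary.Structures using (IsTotalOrder)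
open import Relation.Binary.PropositionalEquality using (_≡_)
open import Algebra.Bundles using (CommutativeRing)

record OrderedCommRing (c ℓ ℓ₂ : Level) : Set (suc (c ⊔ ℓ ⊔ ℓ₂)) where
  field
    commutativeRing : CommutativeRing c ℓ
  open CommutativeRing commutativeRing public
  field
    _≤_           : Rel Carrier ℓ₂
    isTotalOrder  : IsTotalOrder _≈_ _≤_
    +-mono-≤      : ∀ {x y} z → x ≤ y → (x + z) ≤ (y + z)
    *-nonneg      : ∀ {x y} → 0# ≤ x → 0# ≤ y → 0# ≤ (x * y)

allVecs : (k m : ℕ) → List (Vec (Fin m) k)
allVecs zero    m = Vec.[] ∷ []
allVecs (ℕ.suc k) m = concatMap (λ x → map (x Vec.∷_) (allVecs k m)) (allFin m)

isInjB : ∀ {k m} → Vec (Fin m) k → Bool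
isInjB {k} w = all (λ i → all (λ j → if ⌊ lookup w i ≟ᶠ lookup w j ⌋ then ⌊ i ≟ᶠ j ⌋ else true) (allFin k)) (allFin k)

isSurjB : ∀ {k m} → Vec (Fin m) k → Bool
isSurjB {k} {m} w = all (λ b → any (λ i → ⌊ lookup w i ≟ᶠ b ⌋) (allFin k)) (allFin m)

-- The symmetric group S_n: a permutation w is stored as the vector
-- (w(1),…,w(n)) (0-based: Fin n).

Perm : ℕ → Set
Perm n = Vec (Fin n) n

perms : (n : ℕ) → List (Perm n)
perms n = filter (λ w → isInjB w ≟B true) (allVecs n n)
  where
  open import Data.Bool.Properties using () renaming (_≟_ to _≟B_)

compose : ∀ {n} → Perm n → Perm n → Perm n
compose σ τ = tabulate (λ i → lookup σ (lookup τ i))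

w₀ : ∀ n → Perm n
w₀ n = tabulate opposite

-- Compositions of n: lists of positive naturals summing to n.
-- Every composition of n+1 arises uniquely from one of n by either
-- prepending a part 1 or increasing the first part by 1.

compositions : ℕ → List (List ℕ)
compositions zero      = [] ∷ []
compositions (ℕ.suc n) = concatMap ext (compositions n)
  where
  ext : List ℕ → List (List ℕ)
  ext []      = (1 ∷ []) ∷ []
  ext (a ∷ c) = (1 ∷ a ∷ c) ∷ (ℕ.suc a ∷ c) ∷ []

D : List ℕ → List ℕ
D []            = []
D (a ∷ [])      = []
D (a ∷ b ∷ r)   = a ∷ map (a ℕ.+_) (D (b ∷ r))

desFrom : ℕ → List ℕ → List ℕ
desFrom k []            = []
desFrom k (x ∷ [])      = []
desFrom k (x ∷ y ∷ xs)  =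
  if y <ᵇ x then k ∷ desFrom (ℕ.suc k) (y ∷ xs) else desFrom (ℕ.suc k) (y ∷ xs)

Des : ∀ {n} → Perm n → List ℕ
Des w = desFrom 1 (map toℕ (Vec.toList w))

memB : ℕ → List ℕ → Bool
memB x xs = any (λ y → x ≡ᵇ y) xs

desSubB : ∀ {n} → Perm n → List ℕ → Bool
desSubB w α = all (λ i → memB i (D α)) (Des w)

-- Set compositions of [n]: a set composition (F₁,…,F_m) is encoded by
-- m together with the surjection f : [n] → [m] with f(i) = j iff i ∈ F_j.

SetCompCode : ℕ → Set
SetCompCode n = Σ ℕ (λ m → Vec (Fin m) n)

IsSetComp : ∀ {n} → SetCompCode n → Set
IsSetComp (m , f) = ∀ (b : Fin m) → ∃ λ i → lookup f i ≡ b

setComps : (n : ℕ) → List (SetCompCode n)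
setComps n = concatMap (λ m → map (m ,_) (filter (λ f → isSurjB f ≟B true) (allVecs n m))) (upTo (ℕ.suc n))
  where
  open import Data.Bool.Properties using () renaming (_≟_ to _≟B_)

len : ∀ {n} → SetCompCode n → ℕ
len (m , f) = m

typeOf : ∀ {n} → SetCompCode n → List ℕ
typeOf {n} (m , f) = map (λ j → length (filter (λ i → lookup f i ≟ᶠ j) (allFin n))) (allFin m)

refinesB : ∀ {n} → SetCompCode n → SetCompCode n → Bool
refinesB {n} (m , f) (m' , g) =
  all (λ i → all (λ j → if ⌊ lookup f i ≟ᶠ lookup f j ⌋ then ⌊ lookup g i ≟ᶠ lookup g j ⌋ else true) (allFin n)) (allFin n)

nα : ∀ {n} → List ℕ → SetCompCode n → ℕ
nα {n} α F = length (filter (λ G → refinesB F G ∧ ⌊ ≡-decL ℕ._≟_ (typeOf G) α ⌋ ≟B true) (setComps n))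
  where
  open import Data.Bool.Properties using () renaming (_≟_ to _≟B_)

module InRing {c ℓ} (R : CommutativeRing c ℓ) where
  open CommutativeRing R

  fromℕ : ℕ → Carrier
  fromℕ zero      = 0#
  fromℕ (ℕ.suc k) = 1# + fromℕ k

  sign : ℕ → Carrier
  sign zero      = 1#
  sign (ℕ.suc k) = - sign k

  Σ[_]_ : ∀ {A : Set} → List A → (A → Carrier) → Carrier
  Σ[ xs ] f = foldr (λ x acc → f x + acc) 0# xs

  ñα : ∀ {n} → List ℕ → SetCompCode n → Carrier
  ñα {n} α F = sign (n ∸ len F) * fromℕ (nα α F)

  ñγ : ∀ {n} → (List ℕ → Carrier) → SetCompCode n → Carrier
  ñγ {n} γ F = Σ[ compositions n ] (λ α → γ α * ñα α F)

  -- The group algebra kS_n: an element is its coefficient function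
  -- (only the values at permutations matter; all operations below
  -- produce coefficient 0 off S_n except through the inputs).
  KS : ℕ → Set c
  KS n = Perm n → Carrier

  δ : ∀ {n} → Perm n → KS n
  δ w σ = if ⌊ ≡-dec _≟ᶠ_ w σ ⌋ then 1# else 0#

  _⊕_ : ∀ {n} → KS n → KS n → KS n
  (a ⊕ b) σ = a σ + b σ

  _⊙_ : ∀ {n} → Carrier → KS n → KS n
  (k ⊙ a) σ = k * a σ

  ⊝_ : ∀ {n} → KS n → KS n
  (⊝ a) σ = - a σ

  _⊗_ : ∀ {n} → KS n → KS n → KS n
  _⊗_ {n} a b σ = Σ[ perms n ] (λ τ → Σ[ perms n ] (λ ρ →
      if ⌊ ≡-dec _≟ᶠ_ (compose τ ρ) σ ⌋ then a τ * b ρ else 0#))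

  unit : ∀ {n} → KS n
  unit {n} = δ (Vec.tabulate (λ i → i))

  Bα : ∀ {n} → List ℕ → KS n
  Bα {n} α σ = Σ[ perms n ] (λ w → if desSubB w α then δ w σ else 0#)

  Bγ : ∀ {n} → (List ℕ → Carrier) → KS n
  Bγ {n} γ σ = Σ[ compositions n ] (λ α → γ α * Bα α σ)

  prodMinus : ∀ {n} → KS n → List Carrier → KS n
  prodMinus x ks = foldr (λ k acc → (x ⊕ (⊝ (k ⊙ unit))) ⊗ acc) unit ks

  IsZero : ∀ {n} → KS n → Set ℓ
  IsZero {n} a = ∀ (σ : Perm n) → a σ ≈ 0#

{-# OPTIONS --safe #-}
-- Words are the permutations of [n] in one-line notation, and a set composition G
-- acts on them by T G, the stable sort by blocks.  Right multiplication by B_γ is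
-- X = Σ_G w_G T_G with w_G = γ_{type G}, and right multiplication by w₀ is the
-- reversal, which equals Σ_G (-1)^{n-ℓ(G)} T_G.  Since T_F T_G = T_{FG}, where FG
-- refines F and T_{FG} = T_F when F ⪯ G, both operators are triangular for
-- refinement, with diagonal entries n_γ(F) and (-1)^{n-ℓ(F)}.  Let Z be their
-- composite, right multiplication by B_γ w₀; conjugating by w₀ gives w₀ B_γ.
--
-- By induction along refinement, T_F is killed by the product of the factors
-- (Z - k) over any list of k containing ñ_γ(H) for all H ⪯ F.  The delicate case is
-- when ñ_γ(F) = ñ_γ(H) for some H strictly finer than F.  Nonnegativity of γ makes
-- n_γ monotone, so it is constant between H and F, and modulo the remaining factors
-- X is a scalar there.  Reversal squares to 1, hence the vector in question equals
-- its own negative, so it vanishes because an ordered ring has no 2-torsion.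
module Submission where

open import Defs
open import Level using (Level)
open import Data.Nat using (ℕ)
open import Data.List using (List)
open import Data.Product using (_×_; ∃)
open import Function.Bundles using (_⇔_)
open import Data.List.Membership.Propositional using () renaming (_∈_ to _∈ℕ_)
import Data.List.Membership.Setoid as SetoidMembership
import Data.List.Relation.Unary.Unique.Setoid as SetoidUnique

open import Algebra.Bundles using (CommutativeRing)
import Algebra.Properties.Ring as RingProperties
open import Data.Bool using (Bool; true; false; if_then_else_; _∧_; _∨_)
open import Data.Bool.ListAction using (all; any)
open import Data.Bool.Properties using () renaming (_≟_ to _≟B_)
open import Data.Empty using (⊥; ⊥-elim)
open import Data.Fin as Fin using (Fin; zero; suc; toℕ; opposite; combine; punchIn; punchOut; inject₁; _↑ˡ_; _↑ʳ_)
open import Data.Fin.Properties as Finₚ using () renaming (_≟_ to _≟ᶠ_)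
open import Data.List as List using ([]; _∷_; _++_; map; filter; allFin; concat; concatMap; drop; length; reverse; take; upTo)
open import Data.List.Membership.Propositional using (find; lose) renaming (_∈_ to _∈≡_)
open import Data.List.Membership.Propositional.Properties
open import Data.List.Membership.Propositional.Properties.WithK using (unique∧set⇒bag)
import Data.List.Membership.Setoid.Properties as SetoidMembershipₚ
open import Data.List.Properties as Listₚ using (filter-accept; filter-reject; filter-++; filter-none; filter-all; filter-≐)
open import Data.List.Relation.Binary.BagAndSetEquality using (∼bag⇒↭)
open import Data.List.Relation.Binary.Equality.Propositional using (≋⇒≡)
open import Data.List.Relation.Binary.Permutation.Propositional as Perm using (_↭_; ↭-refl; ↭-sym; ↭-trans; ↭-prep; ↭-reflexive)
import Data.List.Relation.Binary.Permutation.Propositional.Properties as Permₚ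
import Data.List.Relation.Binary.Permutation.Setoid.Properties as SetoidPermₚ
open import Data.List.Relation.Unary.All as All using (All; []; _∷_)
import Data.List.Relation.Unary.All.Properties as Allₚ
open import Data.List.Relation.Unary.AllPairs using ([]; _∷_)
import Data.List.Relation.Unary.AllPairs.Properties as AllPairsₚ
open import Data.List.Relation.Unary.Any as Any using (Any; here; there)
import Data.List.Relation.Unary.Any.Properties as Anyₚ
open import Data.List.Relation.Unary.Linked using (Linked; []; [-]; _∷_)
import Data.List.Relation.Unary.Linked.Properties as Linkedₚ
open import Data.List.Relation.Unary.Sorted.TotalOrder.Properties using (↗↭↗⇒≋)
open import Data.List.Relation.Unary.Unique.Propositional using () renaming (Unique to Unique≡)
import Data.List.Relation.Unary.Unique.Propositional.Properties as Uniqueₚ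
open import Data.Nat as ℕ using (zero; suc; _∸_; _<ᵇ_; _≡ᵇ_)
open import Data.Nat.ListAction using (sum)
import Data.Nat.Properties as ℕₚ
open import Data.Product using (_,_; proj₁; proj₂)
open import Data.Sum using (_⊎_; inj₁; inj₂)
open import Data.Vec as Vec using (Vec; []; _∷_; lookup; tabulate; toList)
import Data.Vec.Properties as Vecₚ
open import Function using (_∘_; id; Equivalence; mk⇔)
open import Relation.Binary.Definitions using (DecidableEquality)
open import Relation.Binary.PropositionalEquality as ≡ using (_≡_; _≢_; cong; cong₂; subst)
import Relation.Binary.Reasoning.Setoid as SetoidReasoning
open import Relation.Binary.Structures using (IsTotalOrder)
open import Relation.Nullary using (¬_; ¬?; Dec; yes; no; Reflects; ofʸ; ofⁿ; _because_; contradiction)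
open import Relation.Nullary.Decidable using (⌊_⌋)
open import Relation.Unary using (Decidable)

-- For a triangular operator the product over all diagonal entries with multiplicity vanishes for
-- formal reasons; the content here is that each distinct value suffices once. The argument runs on
-- functions of words instead of inside the group algebra. Right multiplication becomes a pullback,
-- the span of the T_F becomes the set of composites `φ ∘T F` with arbitrary `φ`, and a coefficient
-- of a product is recovered by taking `φ` to be an indicator. Left multiplication permutes letters
-- and commutes with these operators, which reduces the pairing computations to the word `allFin n`.
-- Equality in the ring is not assumed decidable, yet the induction must ask whether two eigenvalues
-- agree. The repetition-free list of eigenvalues answers this: its members are equal exactly when
-- they sit at the same position.

private
  variable
    a b p : Level
    A : Set a
    B : Set b
    I J : Set
    n m k : ℕ


-- Boolean tests and the propositions they reflect

all-reflects : {P : A → Set p} {b : A → Bool} → (∀ x → Reflects (P x) (b x)) →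
               ∀ xs → Reflects (All P xs) (all b xs)
all-reflects r []       = ofʸ []
all-reflects {b = b} r (x ∷ xs) with b x | r x
... | false | ofⁿ ¬px = ofⁿ λ { (px ∷ _) → ¬px px }
... | true  | ofʸ px with all b xs | all-reflects r xs
...   | false | ofⁿ ¬ps = ofⁿ λ { (_ ∷ ps) → ¬ps ps }
...   | true  | ofʸ ps  = ofʸ (px ∷ ps)

any-reflects : {P : A → Set p} {b : A → Bool} → (∀ x → Reflects (P x) (b x)) →
               ∀ xs → Reflects (Any P xs) (any b xs)
any-reflects r []       = ofⁿ λ ()
any-reflects {b = b} r (x ∷ xs) with b x | r x
... | true  | ofʸ px = ofʸ (here px)
... | false | ofⁿ ¬px with any b xs | any-reflects r xs
...   | true  | ofʸ ps  = ofʸ (there ps)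
...   | false | ofⁿ ¬ps = ofⁿ λ { (here px) → ¬px px ; (there ps) → ¬ps ps }

reflects-map : {P Q : Set p} {b : Bool} → (P → Q) → (Q → P) → Reflects P b → Reflects Q b
reflects-map f g (ofʸ x)  = ofʸ (f x)
reflects-map f g (ofⁿ ¬x) = ofⁿ (¬x ∘ g)

∀-reflects : {P : Fin n → Set} {b : Fin n → Bool} → (∀ i → Reflects (P i) (b i)) →
             Reflects (∀ i → P i) (all b (allFin n))
∀-reflects {n} r = reflects-map (λ ps i → All.lookup ps (∈-allFin i)) (λ f → All.tabulate (λ {i} _ → f i))
                                (all-reflects r (allFin n))

∃-reflects : {P : Fin n → Set} {b : Fin n → Bool} → (∀ i → Reflects (P i) (b i)) →
             Reflects (∃ P) (any b (allFin n))
∃-reflects {n} r = reflects-map (λ ps → proj₁ (find ps) , proj₂ (proj₂ (find ps))) (λ (i , q) → lose (∈-allFin i) q)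
                                (any-reflects r (allFin n))

→-reflects : {P Q : Set} {b c : Bool} → Reflects P b → Reflects Q c →
             Reflects (P → Q) (if b then c else true)
→-reflects (ofʸ x)  r = reflects-map (λ y _ → y) (λ f → f x) r
→-reflects (ofⁿ ¬x) r = ofʸ (λ x → contradiction x ¬x)

reflects-true : {P : Set p} {b : Bool} → Reflects P b → P → b ≡ true
reflects-true (ofʸ _)  _ = ≡.refl
reflects-true (ofⁿ ¬x) x = contradiction x ¬x

reflects-false : {P : Set p} {b : Bool} → Reflects P b → ¬ P → b ≡ false
reflects-false (ofʸ x) ¬x = contradiction x ¬x
reflects-false (ofⁿ _) _  = ≡.refl

true-reflects : {P : Set p} {b : Bool} → Reflects P b → b ≡ true → P
true-reflects (ofʸ x) _ = x

reflects-⇔ : {P Q : Set p} {b c : Bool} → Reflects P b → Reflects Q c → (P → Q) → (Q → P) → b ≡ c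
reflects-⇔ (ofʸ x)  s f g = ≡.sym (reflects-true s (f x))
reflects-⇔ (ofⁿ ¬x) s f g = ≡.sym (reflects-false s (¬x ∘ g))

isYes-reflects : {P : Set p} (d : Dec P) → Reflects P ⌊ d ⌋
isYes-reflects (yes x) = ofʸ x
isYes-reflects (no ¬x) = ofⁿ ¬x

-- Set compositions, refinement and the number of blocks

IsInjective : Vec (Fin m) k → Set
IsInjective w = ∀ i j → lookup w i ≡ lookup w j → i ≡ j

isInjB-reflects : (w : Vec (Fin m) k) → Reflects (IsInjective w) (isInjB w)
isInjB-reflects w = ∀-reflects λ i → ∀-reflects λ j →
  →-reflects (isYes-reflects (lookup w i ≟ᶠ lookup w j)) (isYes-reflects (i ≟ᶠ j))

isSurjB-reflects : (w : Vec (Fin m) k) → Reflects (IsSetComp (m , w)) (isSurjB w)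
isSurjB-reflects w = ∀-reflects λ b → ∃-reflects λ i → isYes-reflects (lookup w i ≟ᶠ b)

infix 4 _⪯_ _⪯?_

-- This is only a preorder: reordering the blocks gives set compositions that refine each other.
-- Strict refinement is therefore always measured by the number of blocks.
_⪯_ : SetCompCode n → SetCompCode n → Set
(_ , f) ⪯ (_ , g) = ∀ i j → lookup f i ≡ lookup f j → lookup g i ≡ lookup g j

refinesB-reflects : (F G : SetCompCode n) → Reflects (F ⪯ G) (refinesB F G)
refinesB-reflects (_ , f) (_ , g) = ∀-reflects λ i → ∀-reflects λ j →
  →-reflects (isYes-reflects (lookup f i ≟ᶠ lookup f j)) (isYes-reflects (lookup g i ≟ᶠ lookup g j))

_⪯?_ : (F G : SetCompCode n) → Dec (F ⪯ G)
F ⪯? G = refinesB F G because refinesB-reflects F G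

⪯-refl : (F : SetCompCode n) → F ⪯ F
⪯-refl F i j e = e

⪯-trans : (F G H : SetCompCode n) → F ⪯ G → G ⪯ H → F ⪯ H
⪯-trans F G H p q i j e = q i j (p i j e)

IsSetComp? : (F : SetCompCode n) → Dec (IsSetComp F)
IsSetComp? (m , f) = isSurjB f because isSurjB-reflects f

len≤n : (F : SetCompCode n) → IsSetComp F → len F ℕ.≤ n
len≤n (m , f) s = Finₚ.injective⇒≤ {f = λ b → proj₁ (s b)}
  λ {b} {c} e → ≡.trans (≡.sym (proj₂ (s b))) (≡.trans (cong (lookup f) e) (proj₂ (s c)))

⪯⇒len≥ : (H F : SetCompCode n) → IsSetComp F → H ⪯ F → len F ℕ.≤ len H
⪯⇒len≥ (p , h) (m , f) s r = Finₚ.injective⇒≤ {f = λ b → lookup h (proj₁ (s b))}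
  λ {b} {c} e → ≡.trans (≡.sym (proj₂ (s b))) (≡.trans (r _ _ e) (proj₂ (s c)))

-- If H had the same underlying partition as F, then H ⪯ G would give F ⪯ G. So H splits some block
-- of F, and the labels of the block representatives together with the label of one split-off
-- element are `suc m` distinct labels of H.
⪯∧⋠⇒len< : (H F G : SetCompCode n) → IsSetComp F → H ⪯ F → H ⪯ G → ¬ F ⪯ G → len F ℕ.< len H
⪯∧⋠⇒len< {n} H@(p , h) F@(m , f) G@(q , g) s H⪯F H⪯G F⋠G = Finₚ.injective⇒≤ {f = inj} inj-injective
  where
  rep : Fin m → Fin n
  rep b = proj₁ (s b)

  -- If H separates two elements of a block of F, it separates one of them from
  -- the representative of that block.
  separated : ∃ λ i → lookup h i ≢ lookup h (rep (lookup f i))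
  separated with Finₚ.any? (λ i → ¬? (lookup h i ≟ᶠ lookup h (rep (lookup f i))))
  ... | yes x = x
  ... | no ¬x = contradiction F⪯G F⋠G
    where
    same : ∀ i → lookup h i ≡ lookup h (rep (lookup f i))
    same i with lookup h i ≟ᶠ lookup h (rep (lookup f i))
    ... | yes e = e
    ... | no e  = contradiction (i , e) ¬x
    F⪯G : F ⪯ G
    F⪯G i j e = H⪯G i j (≡.trans (same i) (≡.trans (cong (lookup h ∘ rep) e) (≡.sym (same j))))

  i₀ = proj₁ separated

  inj : Fin (suc m) → Fin p
  inj zero    = lookup h i₀
  inj (suc b) = lookup h (rep b)

  block-eq : ∀ b → lookup h i₀ ≡ lookup h (rep b) → lookup f i₀ ≡ b
  block-eq b e = ≡.trans (H⪯F _ _ e) (proj₂ (s b))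

  clash : ∀ b → lookup h i₀ ≢ lookup h (rep b)
  clash b e = proj₂ separated (≡.trans e (cong (lookup h ∘ rep) (≡.sym (block-eq b e))))

  inj-injective : ∀ {x y} → inj x ≡ inj y → x ≡ y
  inj-injective {zero}  {zero}  e = ≡.refl
  inj-injective {zero}  {suc b} e = contradiction e (clash b)
  inj-injective {suc b} {zero}  e = contradiction (≡.sym e) (clash b)
  inj-injective {suc b} {suc c} e = cong suc (≡.trans (≡.sym (proj₂ (s b))) (≡.trans (H⪯F _ _ e) (proj₂ (s c))))

injective⇒surjective : (w : Vec (Fin n) n) → IsInjective w → ∀ y → ∃ λ x → lookup w x ≡ y
injective⇒surjective {suc n} w inj y with Finₚ.any? (λ x → lookup w x ≟ᶠ y)
... | yes e = e
... | no ¬e = contradiction (Finₚ.injective⇒≤ {f = λ x → punchOut (ne x)}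
                              (λ {i} {j} q → inj i j (Finₚ.punchOut-injective (ne i) (ne j) q)))
                            (ℕₚ.<⇒≱ (ℕₚ.n<1+n n))
  where
  ne : ∀ x → y ≢ lookup w x
  ne x q = ¬e (x , ≡.sym q)

-- Stable sorting by block labels

cat : ∀ m → (Fin m → List A) → List A
cat zero    h = []
cat (suc m) h = h zero ++ cat m (h ∘ suc)

cat-cong : ∀ m {h h′ : Fin m → List A} → (∀ j → h j ≡ h′ j) → cat m h ≡ cat m h′
cat-cong zero    e = ≡.refl
cat-cong (suc m) e = cong₂ _++_ (e zero) (cat-cong m (e ∘ suc))

cat-[] : ∀ m {h : Fin m → List A} → (∀ j → h j ≡ []) → cat m h ≡ []
cat-[] zero    e = ≡.refl
cat-[] (suc m) e rewrite e zero = cat-[] m (e ∘ suc)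

cat-single : ∀ m {h : Fin m → List A} j → (∀ i → i ≢ j → h i ≡ []) → cat m h ≡ h j
cat-single (suc m) {h} zero e = ≡.trans (cong (h zero ++_) (cat-[] m (λ i → e (suc i) λ ()))) (Listₚ.++-identityʳ _)
cat-single (suc m) (suc j) e rewrite e zero (λ ()) = cat-single m j (λ i ne → e (suc i) (ne ∘ Finₚ.suc-injective))

cat-map : ∀ m (f : A → B) (h : Fin m → List A) → map f (cat m h) ≡ cat m (map f ∘ h)
cat-map zero    f h = ≡.refl
cat-map (suc m) f h = ≡.trans (Listₚ.map-++ f (h zero) _) (cong (map f (h zero) ++_) (cat-map m f (h ∘ suc)))

cat-filter : ∀ m {P : A → Set p} (P? : Decidable P) (h : Fin m → List A) →
             filter P? (cat m h) ≡ cat m (filter P? ∘ h)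
cat-filter zero    P? h = ≡.refl
cat-filter (suc m) P? h = ≡.trans (filter-++ P? (h zero) _) (cong (filter P? (h zero) ++_) (cat-filter m P? (h ∘ suc)))

cat-+ : ∀ m k (h : Fin (m ℕ.+ k) → List A) → cat (m ℕ.+ k) h ≡ cat m (λ i → h (i ↑ˡ k)) ++ cat k (λ i → h (m ↑ʳ i))
cat-+ zero    k h = ≡.refl
cat-+ (suc m) k h = ≡.trans (cong (h zero ++_) (cat-+ m k (h ∘ suc))) (≡.sym (Listₚ.++-assoc (h zero) _ _))

cat-* : ∀ m k (h : Fin (m ℕ.* k) → List A) → cat (m ℕ.* k) h ≡ cat m (λ i → cat k (λ j → h (combine i j)))
cat-* zero    k h = ≡.refl
cat-* (suc m) k h = ≡.trans (cat-+ k (m ℕ.* k) h) (cong (cat k (λ j → h (j ↑ˡ _)) ++_) (cat-* m k (λ i → h (k ↑ʳ i))))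

cat-punchIn : ∀ m (b : Fin (suc m)) {h : Fin (suc m) → List A} → h b ≡ [] → cat (suc m) h ≡ cat m (h ∘ punchIn b)
cat-punchIn m zero e rewrite e = ≡.refl
cat-punchIn (suc m) (suc b) {h} e = cong (h zero ++_) (cat-punchIn m b {h ∘ suc} e)

cat-insert : ∀ m {x : A} {h h′ : Fin m → List A} j → h′ j ≡ x ∷ h j → (∀ i → i ≢ j → h′ i ≡ h i) →
             cat m h′ ↭ x ∷ cat m h
cat-insert (suc m) {x} {h} {h′} zero e e′ rewrite e = ↭-reflexive
  (cong (λ z → x ∷ h zero ++ z) (cat-cong m (λ i → e′ (suc i) λ ())))
cat-insert (suc m) {x} {h} {h′} (suc j) e e′ rewrite e′ zero (λ ()) = ↭-trans
  (Permₚ.++⁺ˡ (h zero) (cat-insert m j e (λ i ne → e′ (suc i) (ne ∘ Finₚ.suc-injective))))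
  (Permₚ.shift x (h zero) _)

sort : (Fin n → Fin m) → List (Fin n) → List (Fin n)
sort {m = m} f C = cat m (λ j → filter (λ i → f i ≟ᶠ j) C)

T : SetCompCode n → List (Fin n) → List (Fin n)
T (m , f) = sort (lookup f)

sort-cong : {f g : Fin n → Fin m} → (∀ i → f i ≡ g i) → ∀ C → sort f C ≡ sort g C
sort-cong {m = m} {f} {g} e C = cat-cong m λ j →
  filter-≐ (λ i → f i ≟ᶠ j) (λ i → g i ≟ᶠ j) ((λ {i} q → ≡.trans (≡.sym (e i)) q) , (λ {i} q → ≡.trans (e i) q)) C

sort-↭ : (f : Fin n → Fin m) → ∀ C → sort f C ↭ C
sort-↭ {m = m} f []      = ↭-reflexive (cat-[] m (λ j → ≡.refl))
sort-↭ {m = m} f (x ∷ C) = ↭-trans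
  (cat-insert m (f x) (filter-accept (λ i → f i ≟ᶠ f x) ≡.refl)
    (λ i ne → filter-reject (λ l → f l ≟ᶠ i) (ne ∘ ≡.sym)))
  (↭-prep x (sort-↭ f C))

filter-filter : {P Q R : A → Set p} (P? : Decidable P) (Q? : Decidable Q) (R? : Decidable R) →
                (∀ x → P x → Q x → R x) → (∀ x → R x → P x) → (∀ x → R x → Q x) →
                ∀ xs → filter P? (filter Q? xs) ≡ filter R? xs
filter-filter P? Q? R? pq→r r→p r→q [] = ≡.refl
filter-filter P? Q? R? pq→r r→p r→q (x ∷ xs) with Q? x
... | no ¬q = ≡.trans (filter-filter P? Q? R? pq→r r→p r→q xs) (≡.sym (filter-reject R? (¬q ∘ r→q x)))
... | yes q with P? x
...   | yes p = ≡.trans (cong (x ∷_) (filter-filter P? Q? R? pq→r r→p r→q xs)) (≡.sym (filter-accept R? (pq→r x p q)))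
...   | no ¬p = ≡.trans (filter-filter P? Q? R? pq→r r→p r→q xs) (≡.sym (filter-reject R? (¬p ∘ r→p x)))

-- Stability makes two successive sorts lexicographic, with the later key `f` dominant, and
-- `combine` numbers the pairs of labels in lexicographic order.
sort-sort : (f : Fin n → Fin m) (g : Fin n → Fin k) → ∀ C →
            sort f (sort g C) ≡ sort (λ i → combine (f i) (g i)) C
sort-sort {m = m} {k} f g C = ≡.sym (≡.trans (cat-* m k _) (cat-cong m λ i → ≡.sym (≡.trans
  (cat-filter k (λ l → f l ≟ᶠ i) _)
  (cat-cong k λ j → filter-filter (λ l → f l ≟ᶠ i) (λ l → g l ≟ᶠ j) (λ l → combine (f l) (g l) ≟ᶠ combine i j)
    (λ l → cong₂ combine)
    (λ l → Finₚ.combine-injectiveˡ (f l) (g l) i j)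
    (λ l → Finₚ.combine-injectiveʳ (f l) (g l) i j) C))))

sort-equivariant : (f : Fin n → Fin m) (t : Fin n → Fin n) → ∀ C → sort f (map t C) ≡ map t (sort (f ∘ t) C)
sort-equivariant {m = m} f t C = ≡.sym (≡.trans (cat-map m t _) (cat-cong m λ j → ≡.sym (filter-map′ j C)))
  where
  filter-map′ : ∀ j C → filter (λ i → f i ≟ᶠ j) (map t C) ≡ map t (filter (λ i → f (t i) ≟ᶠ j) C)
  filter-map′ j [] = ≡.refl
  filter-map′ j (x ∷ C) with f (t x) ≟ᶠ j
  ... | yes _ = cong (t x ∷_) (filter-map′ j C)
  ... | no _  = filter-map′ j C

-- Each block of F lies inside one block of G, so sorting by G leaves the relative order of its
-- letters unchanged, and that order is all that sorting by F retains.
T-absorb : (F G : SetCompCode n) → IsSetComp F → F ⪯ G → ∀ C → T F (T G C) ≡ T F C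
T-absorb {n} (m , f) (k , g) s F⪯G C = cat-cong m λ j → ≡.trans
  (cat-filter k (λ i → lookup f i ≟ᶠ j) _)
  -- The one block of G that meets block `j` of F is the block of the representative `proj₁ (s j)`;
  -- the others contribute the empty list.
  (≡.trans (cat-single k (lookup g (proj₁ (s j))) λ b ne → ≡.trans
      (filter-filter (λ i → lookup f i ≟ᶠ j) (λ i → lookup g i ≟ᶠ b) never?
        (λ i p q → ne (≡.trans (≡.sym q) (F⪯G _ _ (≡.trans p (≡.sym (proj₂ (s j))))))) (λ i ()) (λ i ()) C)
      (filter-none never? {C} (All.tabulate λ _ ())))
    (filter-filter (λ i → lookup f i ≟ᶠ j) (λ i → lookup g i ≟ᶠ lookup g (proj₁ (s j))) (λ i → lookup f i ≟ᶠ j)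
      (λ i p q → p) (λ i p → p) (λ i p → F⪯G _ _ (≡.trans p (≡.sym (proj₂ (s j))))) C))
  where
  never? : Decidable {A = Fin n} (λ _ → ⊥)
  never? _ = no λ ()

-- The product of set compositions

record Normalised {n M} (f : Fin n → Fin M) : Set where
  field
    code      : SetCompCode n
    isSetComp : IsSetComp code
    T-code    : ∀ C → T code C ≡ sort f C
    finer     : ∀ i j → lookup (proj₂ code) i ≡ lookup (proj₂ code) j → f i ≡ f j

normalise : ∀ M (f : Fin n → Fin M) → Normalised f
normalise {n} zero f = record
  { code = zero , tabulate f ; isSetComp = λ () ; T-code = λ C → ≡.refl
  ; finer = λ i → ⊥-elim (Finₚ.¬Fin0 (f i)) }
normalise {n} (suc M) f with Finₚ.all? (λ b → Finₚ.any? (λ i → f i ≟ᶠ b))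
... | yes s = record
  { code = suc M , tabulate f
  ; isSetComp = λ b → proj₁ (s b) , ≡.trans (Vecₚ.lookup∘tabulate f _) (proj₂ (s b))
  ; T-code = sort-cong (Vecₚ.lookup∘tabulate f)
  ; finer = λ i j e → ≡.trans (≡.sym (Vecₚ.lookup∘tabulate f i)) (≡.trans e (Vecₚ.lookup∘tabulate f j)) }
... | no ¬s with Finₚ.¬∀⟶∃¬ (suc M) _ (λ b → Finₚ.any? (λ i → f i ≟ᶠ b)) ¬s
...   | b , ¬∃ = record
  { code = N.code
  ; isSetComp = N.isSetComp
  ; T-code = λ C → ≡.trans (N.T-code C) (≡.sym (sort-punch C))
  ; finer = λ i j e → Finₚ.punchOut-injective (ne i) (ne j) (N.finer i j e) }
  where
  ne : ∀ i → b ≢ f i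
  ne i e = ¬∃ (i , ≡.sym e)
  f′ : Fin n → Fin M
  f′ i = punchOut (ne i)
  module N = Normalised (normalise M f′)
  sort-punch : ∀ C → sort f C ≡ sort f′ C
  sort-punch C = ≡.trans
    (cat-punchIn M b {λ j → filter (λ i → f i ≟ᶠ j) C} (filter-none (λ i → f i ≟ᶠ b) {C} (All.tabulate λ {i} _ e → ne i (≡.sym e))))
    (cat-cong M λ j → filter-≐ (λ i → f i ≟ᶠ punchIn b j) (λ i → f′ i ≟ᶠ j)
      ( (λ {i} e → Finₚ.punchIn-injective b _ _ (≡.trans (Finₚ.punchIn-punchOut (ne i)) e))
      , (λ {i} e → ≡.trans (≡.sym (Finₚ.punchIn-punchOut (ne i))) (cong (punchIn b) e))) C)

module _ (F G : SetCompCode n) where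
  private
    f = lookup (proj₂ F)
    g = lookup (proj₂ G)
    module N = Normalised (normalise (len F ℕ.* len G) (λ i → combine (f i) (g i)))

  -- The Tits product FG: the nonempty intersections of a block of F with a block of G, in
  -- lexicographic order.
  join : SetCompCode n
  join = N.code

  join-isSetComp : IsSetComp join
  join-isSetComp = N.isSetComp

  T-join : ∀ C → T join C ≡ T F (T G C)
  T-join C = ≡.trans (N.T-code C) (≡.sym (sort-sort f g C))

  join-⪯ˡ : join ⪯ F
  join-⪯ˡ i j e = Finₚ.combine-injectiveˡ (f i) (g i) (f j) (g j) (N.finer i j e)

  join-⪯ʳ : join ⪯ G
  join-⪯ʳ i j e = Finₚ.combine-injectiveʳ (f i) (g i) (f j) (g j) (N.finer i j e)

-- Repetition-free enumerations and bijections between them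

concatMap-unique : {g : A → List B} {xs : List A} → Unique≡ xs → (∀ x → Unique≡ (g x)) →
                   (∀ {x y z} → z ∈≡ g x → z ∈≡ g y → x ≡ y) → Unique≡ (concatMap g xs)
concatMap-unique []        u d = []
concatMap-unique {g = g} {x ∷ xs} (x∉ ∷ xs!) u d = Uniqueₚ.++⁺ (u x) (concatMap-unique xs! u d) disjoint
  where
  disjoint : ∀ {z} → ¬ (z ∈≡ g x × z ∈≡ concatMap g xs)
  disjoint (z∈ , z∈′) with find (∈-concatMap⁻ g z∈′)
  ... | y , y∈ , z∈gy = All.lookup x∉ y∈ (d z∈ z∈gy)

map-unique : {f : A → B} {xs : List A} → Unique≡ xs → (∀ {x y} → x ∈≡ xs → y ∈≡ xs → f x ≡ f y → x ≡ y) →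
             Unique≡ (map f xs)
map-unique []         inj = []
map-unique {f = f} (x∉ ∷ xs!) inj =
  Allₚ.map⁺ (All.tabulate λ y∈ e → All.lookup x∉ y∈ (inj (here ≡.refl) (there y∈) e))
  ∷ map-unique xs! (λ x∈ y∈ → inj (there x∈) (there y∈))

map-bijection-↭ : {xs : List A} {ys : List B} → Unique≡ xs → Unique≡ ys → (f : A → B) →
                  (∀ {x} → x ∈≡ xs → f x ∈≡ ys) →
                  (∀ {x y} → x ∈≡ xs → y ∈≡ xs → f x ≡ f y → x ≡ y) →
                  (∀ {y} → y ∈≡ ys → ∃ λ x → x ∈≡ xs × y ≡ f x) →
                  map f xs ↭ ys
map-bijection-↭ xs! ys! f to inj onto = ∼bag⇒↭ (unique∧set⇒bag (map-unique xs! inj) ys! (mk⇔ into back))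
  where
  into : ∀ {z} → z ∈≡ map f _ → z ∈≡ _
  into z∈ with ∈-map⁻ f z∈
  ... | x , x∈ , ≡.refl = to x∈
  back : ∀ {z} → z ∈≡ _ → z ∈≡ map f _
  back z∈ with onto z∈
  ... | x , x∈ , ≡.refl = ∈-map⁺ f x∈

∈-allVecs : ∀ k m (v : Vec (Fin m) k) → v ∈≡ allVecs k m
∈-allVecs zero    m []      = here ≡.refl
∈-allVecs (suc k) m (x ∷ v) = ∈-concatMap⁺ _ (lose (∈-allFin x) (∈-map⁺ (x Vec.∷_) (∈-allVecs k m v)))

allVecs-unique : ∀ k m → Unique≡ (allVecs k m)
allVecs-unique zero    m = [] ∷ []
allVecs-unique (suc k) m = concatMap-unique (Uniqueₚ.allFin⁺ m)
  (λ x → Uniqueₚ.map⁺ Vecₚ.∷-injectiveʳ (allVecs-unique k m)) same-head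
  where
  same-head : ∀ {x y} {z : Vec (Fin m) (suc k)} → z ∈≡ map (x Vec.∷_) (allVecs k m) → z ∈≡ map (y Vec.∷_) (allVecs k m) → x ≡ y
  same-head p q with ∈-map⁻ _ p | ∈-map⁻ _ q
  ... | _ , _ , ≡.refl | _ , _ , e = Vecₚ.∷-injectiveˡ e

∈-perms⁺ : {w : Perm n} → IsInjective w → w ∈≡ perms n
∈-perms⁺ {n} {w} i = ∈-filter⁺ (λ v → isInjB v ≟B true) (∈-allVecs n n w) (reflects-true (isInjB-reflects w) i)

∈-perms⁻ : {w : Perm n} → w ∈≡ perms n → IsInjective w
∈-perms⁻ {n} {w} w∈ = true-reflects (isInjB-reflects w) (proj₂ (∈-filter⁻ (λ v → isInjB v ≟B true) {xs = allVecs n n} w∈))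

perms-unique : ∀ n → Unique≡ (perms n)
perms-unique n = Uniqueₚ.filter⁺ (λ v → isInjB v ≟B true) (allVecs-unique n n)

surjections : ∀ n m → List (Vec (Fin m) n)
surjections n m = filter (λ f → isSurjB f ≟B true) (allVecs n m)

∈-setComps⁺ : {F : SetCompCode n} → IsSetComp F → F ∈≡ setComps n
∈-setComps⁺ {n} {F@(m , f)} s = ∈-concatMap⁺ (λ m → map (m ,_) (surjections n m))
  (lose (∈-upTo⁺ (ℕ.s≤s (len≤n F s)))
        (∈-map⁺ (m ,_) (∈-filter⁺ (λ f → isSurjB f ≟B true) (∈-allVecs n m f) (reflects-true (isSurjB-reflects f) s))))

∈-setComps⁻ : {F : SetCompCode n} → F ∈≡ setComps n → IsSetComp F
∈-setComps⁻ {n} F∈ with find (∈-concatMap⁻ (λ m → map (m ,_) (surjections n m)) {xs = upTo (suc n)} F∈)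
... | m , _ , F∈′ with ∈-map⁻ (m ,_) F∈′
...   | f , f∈ , ≡.refl = true-reflects (isSurjB-reflects f) (proj₂ (∈-filter⁻ (λ f → isSurjB f ≟B true) {xs = allVecs n m} f∈))

setComps-unique : ∀ n → Unique≡ (setComps n)
setComps-unique n = concatMap-unique (Uniqueₚ.upTo⁺ (suc n))
  (λ m → Uniqueₚ.map⁺ (λ { ≡.refl → ≡.refl }) (Uniqueₚ.filter⁺ _ (allVecs-unique n m))) same-length
  where
  same-length : ∀ {m k z} → z ∈≡ map (m ,_) (surjections n m) → z ∈≡ map (k ,_) (surjections n k) → m ≡ k
  same-length p q with ∈-map⁻ _ p | ∈-map⁻ _ q
  ... | _ , _ , ≡.refl | _ , _ , e = cong proj₁ e

-- Surjectivity after prepending one label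

missB : Fin m → Vec (Fin m) n → Bool
missB x []      = true
missB x (y ∷ f) = if ⌊ x ≟ᶠ y ⌋ then false else missB x f

missB-reflects : (x : Fin m) (f : Vec (Fin m) n) → Reflects (∀ i → lookup f i ≢ x) (missB x f)
missB-reflects x []      = ofʸ λ ()
missB-reflects x (y ∷ f) with x ≟ᶠ y
... | yes ≡.refl = ofⁿ λ p → p zero ≡.refl
... | no ne    = reflects-map (λ { p zero → ne ∘ ≡.sym ; p (suc i) → p i }) (λ p → p ∘ suc) (missB-reflects x f)

missB-punchIn : (x : Fin (suc m)) (y : Fin m) → ⌊ x ≟ᶠ punchIn x y ⌋ ≡ false
missB-punchIn x y = reflects-false (isYes-reflects (x ≟ᶠ punchIn x y)) (Finₚ.punchInᵢ≢i x y ∘ ≡.sym)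

isSurjB-∷-hit : (x : Fin m) (f : Vec (Fin m) n) → missB x f ≡ false → isSurjB (x ∷ f) ≡ isSurjB f
isSurjB-∷-hit x f e = reflects-⇔ (isSurjB-reflects (x ∷ f)) (isSurjB-reflects f) to from
  where
  to : IsSetComp (_ , x ∷ f) → IsSetComp (_ , f)
  to s b with s b
  ... | suc i , q = i , q
  ... | zero , ≡.refl with Finₚ.any? (λ i → lookup f i ≟ᶠ x)
  ...   | yes q = q
  ...   | no ¬q = contradiction (≡.trans (≡.sym e) (reflects-true (missB-reflects x f) (λ i q → ¬q (i , q)))) λ ()
  from : IsSetComp (_ , f) → IsSetComp (_ , x ∷ f)
  from s b = suc (proj₁ (s b)) , proj₂ (s b)

isSurjB-miss : (x : Fin m) (f : Vec (Fin m) n) → missB x f ≡ true → isSurjB f ≡ false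
isSurjB-miss x f e = reflects-false (isSurjB-reflects f) λ s →
  true-reflects (missB-reflects x f) e (proj₁ (s x)) (proj₂ (s x))

isSurjB-∷-punchIn : (x : Fin (suc m)) (f : Vec (Fin m) n) → isSurjB (x ∷ Vec.map (punchIn x) f) ≡ isSurjB f
isSurjB-∷-punchIn x f = reflects-⇔ (isSurjB-reflects (x ∷ Vec.map (punchIn x) f)) (isSurjB-reflects f) to from
  where
  to : IsSetComp (_ , x ∷ Vec.map (punchIn x) f) → IsSetComp (_ , f)
  to s b with s (punchIn x b)
  ... | zero  , q = contradiction (≡.sym q) (Finₚ.punchInᵢ≢i x b)
  ... | suc i , q = i , Finₚ.punchIn-injective x _ _ (≡.trans (≡.sym (Vecₚ.lookup-map i (punchIn x) f)) q)
  from : IsSetComp (_ , f) → IsSetComp (_ , x ∷ Vec.map (punchIn x) f)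
  from s b with x ≟ᶠ b
  ... | yes q = zero , q
  ... | no q with s (punchOut q)
  ...   | i , r = suc i , ≡.trans (Vecₚ.lookup-map i (punchIn x) f) (≡.trans (cong (punchIn x) r) (Finₚ.punchIn-punchOut q))

-- Finite sums over the enumerations

module Sums {c ℓ} (R : CommutativeRing c ℓ) where
  open CommutativeRing R hiding (zero)
  open InRing R
  open SetoidReasoning setoid

  +-interchange : ∀ a b c d → (a + b) + (c + d) ≈ (a + c) + (b + d)
  +-interchange a b c d = begin
    (a + b) + (c + d)  ≈⟨ +-assoc a b (c + d) ⟩
    a + (b + (c + d))  ≈⟨ +-congˡ (sym (+-assoc b c d)) ⟩
    a + ((b + c) + d)  ≈⟨ +-congˡ (+-congʳ (+-comm b c)) ⟩
    a + ((c + b) + d)  ≈⟨ +-congˡ (+-assoc c b d) ⟩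
    a + (c + (b + d))  ≈⟨ +-assoc a c (b + d) ⟨
    (a + c) + (b + d)  ∎

  *-swap : ∀ a b c → a * (b * c) ≈ b * (a * c)
  *-swap a b c = trans (sym (*-assoc a b c)) (trans (*-congʳ (*-comm a b)) (*-assoc b a c))

  Σ-cong-∈ : ∀ (xs : List I) {h h′ : I → Carrier} → (∀ {x} → x ∈≡ xs → h x ≈ h′ x) → Σ[ xs ] h ≈ Σ[ xs ] h′
  Σ-cong-∈ []       e = refl
  Σ-cong-∈ (x ∷ xs) e = +-cong (e (here ≡.refl)) (Σ-cong-∈ xs (e ∘ there))

  Σ-cong : ∀ (xs : List I) {h h′ : I → Carrier} → (∀ x → h x ≈ h′ x) → Σ[ xs ] h ≈ Σ[ xs ] h′
  Σ-cong xs e = Σ-cong-∈ xs (λ {x} _ → e x)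

  Σ-0 : ∀ (xs : List I) {h : I → Carrier} → (∀ {x} → x ∈≡ xs → h x ≈ 0#) → Σ[ xs ] h ≈ 0#
  Σ-0 []       e = refl
  Σ-0 (x ∷ xs) e = trans (+-cong (e (here ≡.refl)) (Σ-0 xs (e ∘ there))) (+-identityˡ 0#)

  Σ-+ : ∀ (xs : List I) (h h′ : I → Carrier) → Σ[ xs ] (λ x → h x + h′ x) ≈ Σ[ xs ] h + Σ[ xs ] h′
  Σ-+ []       h h′ = sym (+-identityˡ 0#)
  Σ-+ (x ∷ xs) h h′ = trans (+-congˡ (Σ-+ xs h h′)) (+-interchange _ _ _ _)

  Σ-*ˡ : ∀ (xs : List I) a (h : I → Carrier) → Σ[ xs ] (λ x → a * h x) ≈ a * Σ[ xs ] h
  Σ-*ˡ []       a h = sym (zeroʳ a)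
  Σ-*ˡ (x ∷ xs) a h = trans (+-congˡ (Σ-*ˡ xs a h)) (sym (distribˡ a _ _))

  Σ-*ʳ : ∀ (xs : List I) a (h : I → Carrier) → Σ[ xs ] (λ x → h x * a) ≈ Σ[ xs ] h * a
  Σ-*ʳ xs a h = trans (Σ-cong xs (λ x → *-comm (h x) a)) (trans (Σ-*ˡ xs a h) (*-comm a _))

  Σ-++ : ∀ (xs ys : List I) (h : I → Carrier) → Σ[ xs ++ ys ] h ≈ Σ[ xs ] h + Σ[ ys ] h
  Σ-++ []       ys h = sym (+-identityˡ _)
  Σ-++ (x ∷ xs) ys h = trans (+-congˡ (Σ-++ xs ys h)) (sym (+-assoc _ _ _))

  Σ-map : ∀ (xs : List I) (f : I → J) (h : J → Carrier) → Σ[ map f xs ] h ≈ Σ[ xs ] (h ∘ f)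
  Σ-map []       f h = refl
  Σ-map (x ∷ xs) f h = +-congˡ (Σ-map xs f h)

  Σ-concatMap : ∀ (xs : List I) (g : I → List J) (h : J → Carrier) →
                Σ[ concatMap g xs ] h ≈ Σ[ xs ] (λ x → Σ[ g x ] h)
  Σ-concatMap []       g h = refl
  Σ-concatMap (x ∷ xs) g h = trans (Σ-++ (g x) _ h) (+-congˡ (Σ-concatMap xs g h))

  Σ-swap : ∀ (xs : List I) (ys : List J) (h : I → J → Carrier) →
           Σ[ xs ] (λ x → Σ[ ys ] (h x)) ≈ Σ[ ys ] (λ y → Σ[ xs ] (λ x → h x y))
  Σ-swap []       ys h = sym (Σ-0 ys (λ _ → refl))
  Σ-swap (x ∷ xs) ys h = trans (+-congˡ (Σ-swap xs ys h)) (sym (Σ-+ ys (h x) _))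

  Σ-filter : ∀ (b : I → Bool) (xs : List I) (h : I → Carrier) →
             Σ[ filter (λ x → b x ≟B true) xs ] h ≈ Σ[ xs ] (λ x → if b x then h x else 0#)
  Σ-filter b []       h = refl
  Σ-filter b (x ∷ xs) h with b x
  ... | true  = +-congˡ (Σ-filter b xs h)
  ... | false = trans (Σ-filter b xs h) (sym (+-identityˡ _))

  Σ-↭ : {xs ys : List I} (h : I → Carrier) → xs ↭ ys → Σ[ xs ] h ≈ Σ[ ys ] h
  Σ-↭ h Perm.refl         = refl
  Σ-↭ h (Perm.prep x p)   = +-congˡ (Σ-↭ h p)
  Σ-↭ h (Perm.swap x y p) = trans (sym (+-assoc _ _ _)) (trans (+-cong (+-comm _ _) (Σ-↭ h p)) (+-assoc _ _ _))
  Σ-↭ h (Perm.trans p q)  = trans (Σ-↭ h p) (Σ-↭ h q)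

  Σ-bijection : {xs : List I} {ys : List J} (h : J → Carrier) → Unique≡ xs → Unique≡ ys → (f : I → J) →
                (∀ {x} → x ∈≡ xs → f x ∈≡ ys) →
                (∀ {x y} → x ∈≡ xs → y ∈≡ xs → f x ≡ f y → x ≡ y) →
                (∀ {y} → y ∈≡ ys → ∃ λ x → x ∈≡ xs × y ≡ f x) →
                Σ[ xs ] (h ∘ f) ≈ Σ[ ys ] h
  Σ-bijection {xs = xs} h xs! ys! f to inj onto =
    trans (sym (Σ-map xs f h)) (Σ-↭ h (map-bijection-↭ xs! ys! f to inj onto))

  Σ-allFin-suc : ∀ m (h : Fin (suc m) → Carrier) → Σ[ allFin (suc m) ] h ≈ h zero + Σ[ allFin m ] (h ∘ suc)
  Σ-allFin-suc m h = +-congˡ (trans (reflexive (cong (λ z → Σ[ z ] h) (≡.sym (Listₚ.map-tabulate id suc)))) (Σ-map (allFin m) suc h))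

  Σ-allFin-punchIn : ∀ m x (h : Fin (suc m) → Carrier) → Σ[ allFin (suc m) ] h ≈ h x + Σ[ allFin m ] (h ∘ punchIn x)
  Σ-allFin-punchIn m       zero    h = Σ-allFin-suc m h
  Σ-allFin-punchIn (suc m) (suc x) h = begin
    Σ[ allFin (suc (suc m)) ] h
      ≈⟨ Σ-allFin-suc (suc m) h ⟩
    h zero + Σ[ allFin (suc m) ] (h ∘ suc)
      ≈⟨ +-congˡ (Σ-allFin-punchIn m x (h ∘ suc)) ⟩
    h zero + (h (suc x) + Σ[ allFin m ] (h ∘ suc ∘ punchIn x))
      ≈⟨ +-assoc _ _ _ ⟨
    (h zero + h (suc x)) + Σ[ allFin m ] (h ∘ suc ∘ punchIn x)
      ≈⟨ +-congʳ (+-comm _ _) ⟩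
    (h (suc x) + h zero) + Σ[ allFin m ] (h ∘ suc ∘ punchIn x)
      ≈⟨ +-assoc _ _ _ ⟩
    h (suc x) + (h zero + Σ[ allFin m ] (h ∘ suc ∘ punchIn x))
      ≈⟨ +-congˡ (Σ-allFin-suc m (h ∘ punchIn (suc x))) ⟨
    h (suc x) + Σ[ allFin (suc m) ] (h ∘ punchIn (suc x)) ∎

  Σ-allFin-last : ∀ m (h : Fin (suc m) → Carrier) → Σ[ allFin (suc m) ] h ≈ h (Fin.fromℕ m) + Σ[ allFin m ] (h ∘ inject₁)
  Σ-allFin-last m h = trans (Σ-allFin-punchIn m (Fin.fromℕ m) h)
    (+-congˡ (Σ-cong (allFin m) (λ x → reflexive (cong h (punchIn-last x)))))
    where
    punchIn-last : ∀ {m} (x : Fin m) → punchIn (Fin.fromℕ m) x ≡ inject₁ x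
    punchIn-last zero    = ≡.refl
    punchIn-last (suc x) = cong suc (punchIn-last x)

  Σ-allVecs-suc : ∀ n m (h : Vec (Fin m) (suc n) → Carrier) →
                  Σ[ allVecs (suc n) m ] h ≈ Σ[ allFin m ] (λ x → Σ[ allVecs n m ] (λ f → h (x ∷ f)))
  Σ-allVecs-suc n m h = trans (Σ-concatMap (allFin m) _ h) (Σ-cong (allFin m) (λ x → Σ-map (allVecs n m) (x Vec.∷_) h))

  -- The vectors that avoid the label `x` are the images under `punchIn x` of all vectors over one
  -- label fewer. Peeling off the first entry matches the recursion that defines `missB`.
  Σ-allVecs-miss : ∀ n m x (h : Vec (Fin (suc m)) n → Carrier) →
                   Σ[ allVecs n (suc m) ] (λ f → if missB x f then h f else 0#) ≈
                   Σ[ allVecs n m ] (λ f → h (Vec.map (punchIn x) f))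
  Σ-allVecs-miss zero    m x h = refl
  Σ-allVecs-miss (suc n) m x h = begin
    Σ[ allVecs (suc n) (suc m) ] g
      ≈⟨ Σ-allVecs-suc n (suc m) g ⟩
    Σ[ allFin (suc m) ] g′
      ≈⟨ Σ-allFin-punchIn m x g′ ⟩
    g′ x + Σ[ allFin m ] (g′ ∘ punchIn x)
      ≈⟨ +-congʳ (Σ-0 (allVecs n (suc m)) (λ {f} _ → reflexive (cong (λ b → if (if b then false else missB x f) then h (x ∷ f) else 0#) (reflects-true (isYes-reflects (x ≟ᶠ x)) ≡.refl)))) ⟩
    0# + Σ[ allFin m ] (g′ ∘ punchIn x)
      ≈⟨ +-identityˡ _ ⟩
    Σ[ allFin m ] (g′ ∘ punchIn x)
      ≈⟨ Σ-cong (allFin m) (λ y → trans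
           (Σ-cong (allVecs n (suc m)) (λ f → reflexive (cong (λ b → if (if b then false else missB x f) then h (punchIn x y ∷ f) else 0#) (missB-punchIn x y))))
           (Σ-allVecs-miss n m x (λ f → h (punchIn x y ∷ f)))) ⟩
    Σ[ allFin m ] (λ y → Σ[ allVecs n m ] (λ f → h (punchIn x y ∷ Vec.map (punchIn x) f)))
      ≈⟨ Σ-allVecs-suc n m _ ⟨
    Σ[ allVecs (suc n) m ] (λ f → h (Vec.map (punchIn x) f)) ∎
    where
    g : Vec (Fin (suc m)) (suc n) → Carrier
    g f = if missB x f then h f else 0#
    g′ : Fin (suc m) → Carrier
    g′ y = Σ[ allVecs n (suc m) ] (λ f → g (y ∷ f))

  -- Surjectivity is a guard on a sum over all vectors, so that the sum can be split at the first
  -- entry.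
  Σ-surj : ∀ n m → (Vec (Fin m) n → Carrier) → Carrier
  Σ-surj n m h = Σ[ allVecs n m ] (λ f → if isSurjB f then h f else 0#)

  Σ-surj-cong : ∀ n m {h h′ : Vec (Fin m) n → Carrier} → (∀ f → h f ≈ h′ f) → Σ-surj n m h ≈ Σ-surj n m h′
  Σ-surj-cong n m {h} {h′} e = Σ-cong (allVecs n m) eq
    where
    eq : ∀ f → (if isSurjB f then h f else 0#) ≈ (if isSurjB f then h′ f else 0#)
    eq f with isSurjB f
    ... | true  = e f
    ... | false = refl

  Σ-surj-> : ∀ n m h → n ℕ.< m → Σ-surj n m h ≈ 0#
  Σ-surj-> n m h n<m = Σ-0 (allVecs n m) (λ {f} _ → reflexive (cong (λ b → if b then h f else 0#)
    (reflects-false (isSurjB-reflects f) (λ s → ℕₚ.<⇒≱ n<m (len≤n (m , f) s)))))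

  Σ-setComps : ∀ n (h : SetCompCode n → Carrier) →
               Σ[ setComps n ] h ≈ Σ[ upTo (suc n) ] (λ m → Σ-surj n m (λ f → h (m , f)))
  Σ-setComps n h = trans (Σ-concatMap (upTo (suc n)) (λ m → map (m ,_) (surjections n m)) h) (Σ-cong (upTo (suc n)) (λ m → trans
    (Σ-map (surjections n m) (m ,_) h) (Σ-filter isSurjB (allVecs n m) (λ f → h (m , f)))))

  -- A surjection x ∷ f either has f surjective already, or f misses exactly x.
  Σ-surj-suc : ∀ n m (h : Vec (Fin (suc m)) (suc n) → Carrier) →
               Σ-surj (suc n) (suc m) h ≈
               Σ[ allFin (suc m) ] (λ x → Σ-surj n (suc m) (λ f → h (x ∷ f))) +
               Σ[ allFin (suc m) ] (λ x → Σ-surj n m (λ f → h (x ∷ Vec.map (punchIn x) f)))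
  Σ-surj-suc n m h = begin
    Σ-surj (suc n) (suc m) h
      ≈⟨ Σ-allVecs-suc n (suc m) _ ⟩
    Σ[ allFin (suc m) ] (λ x → Σ[ allVecs n (suc m) ] (λ f → if isSurjB (x ∷ f) then h (x ∷ f) else 0#))
      ≈⟨ Σ-cong (allFin (suc m)) split ⟩
    Σ[ allFin (suc m) ] (λ x → Σ-surj n (suc m) (λ f → h (x ∷ f)) + Σ-surj n m (λ f → h (x ∷ Vec.map (punchIn x) f)))
      ≈⟨ Σ-+ (allFin (suc m)) _ _ ⟩
    _ ∎
    where
    surj∷ : ∀ x → Vec (Fin (suc m)) n → Carrier
    surj∷ x f = if isSurjB (x ∷ f) then h (x ∷ f) else 0#

    pointwise : ∀ x f → surj∷ x f ≈
                (if isSurjB f then h (x ∷ f) else 0#) + (if missB x f then surj∷ x f else 0#)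
    pointwise x f with missB x f in e
    ... | true  rewrite isSurjB-miss x f e = sym (+-identityˡ _)
    ... | false = trans (reflexive (cong (λ b → if b then h (x ∷ f) else 0#) (isSurjB-∷-hit x f e))) (sym (+-identityʳ _))

    split : ∀ x → Σ[ allVecs n (suc m) ] (surj∷ x) ≈
            Σ-surj n (suc m) (λ f → h (x ∷ f)) + Σ-surj n m (λ f → h (x ∷ Vec.map (punchIn x) f))
    split x = begin
      Σ[ allVecs n (suc m) ] (surj∷ x)
        ≈⟨ Σ-cong (allVecs n (suc m)) (pointwise x) ⟩
      Σ[ allVecs n (suc m) ] (λ f → (if isSurjB f then h (x ∷ f) else 0#) + (if missB x f then surj∷ x f else 0#))
        ≈⟨ Σ-+ (allVecs n (suc m)) _ _ ⟩
      Σ-surj n (suc m) (λ f → h (x ∷ f)) + Σ[ allVecs n (suc m) ] (λ f → if missB x f then surj∷ x f else 0#)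
        ≈⟨ +-congˡ (trans (Σ-allVecs-miss n m x (surj∷ x)) (Σ-cong (allVecs n m) (λ f →
             reflexive (cong (λ b → if b then h (x ∷ Vec.map (punchIn x) f) else 0#) (isSurjB-∷-punchIn x f))))) ⟩
      Σ-surj n (suc m) (λ f → h (x ∷ f)) + Σ-surj n m (λ f → h (x ∷ Vec.map (punchIn x) f)) ∎

  Σ-upTo-suc : ∀ n (h : ℕ → Carrier) → Σ[ upTo (suc n) ] h ≈ h 0 + Σ[ upTo n ] (h ∘ suc)
  Σ-upTo-suc n h = +-congˡ (trans (reflexive (cong (λ z → Σ[ z ] h) (≡.sym (Listₚ.map-applyUpTo id suc n)))) (Σ-map (upTo n) suc h))

  -- Every interior `u m` occurs twice with opposite signs. In the application `u m` collects the
  -- words in which the letter 0 is added to one of `m` existing blocks.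
  telescope : ∀ n (u : ℕ → Carrier) →
              Σ[ upTo (suc n) ] (λ m → sign (n ∸ m) * (u (suc m) + u m)) ≈ u (suc n) + sign n * u 0
  telescope zero u = begin
    1# * (u 1 + u 0) + 0#    ≈⟨ +-identityʳ _ ⟩
    1# * (u 1 + u 0)         ≈⟨ distribˡ _ _ _ ⟩
    1# * u 1 + 1# * u 0      ≈⟨ +-congʳ (*-identityˡ _) ⟩
    u 1 + 1# * u 0           ∎
  telescope (suc n) u = begin
    Σ[ upTo (suc (suc n)) ] (λ m → sign (suc n ∸ m) * (u (suc m) + u m))
      ≈⟨ Σ-upTo-suc (suc n) _ ⟩
    - sign n * (u 1 + u 0) + Σ[ upTo (suc n) ] (λ m → sign (n ∸ m) * (u (suc (suc m)) + u (suc m)))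
      ≈⟨ +-cong (distribˡ _ _ _) (telescope n (u ∘ suc)) ⟩
    (- sign n * u 1 + - sign n * u 0) + (u (suc (suc n)) + sign n * u 1)
      ≈⟨ +-cong (+-comm _ _) (+-comm _ _) ⟩
    (- sign n * u 0 + - sign n * u 1) + (sign n * u 1 + u (suc (suc n)))
      ≈⟨ +-assoc _ _ _ ⟩
    - sign n * u 0 + (- sign n * u 1 + (sign n * u 1 + u (suc (suc n))))
      ≈⟨ +-congˡ (+-assoc _ _ _) ⟨
    - sign n * u 0 + ((- sign n * u 1 + sign n * u 1) + u (suc (suc n)))
      ≈⟨ +-congˡ (+-congʳ (trans (sym (distribʳ _ _ _)) (trans (*-congʳ (-‿inverseˡ _)) (zeroˡ _)))) ⟩
    - sign n * u 0 + (0# + u (suc (suc n)))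
      ≈⟨ +-congˡ (+-identityˡ _) ⟩
    - sign n * u 0 + u (suc (suc n))
      ≈⟨ +-comm _ _ ⟩
    u (suc (suc n)) + - sign n * u 0 ∎

-- Sorted words after insertion of the letter 0

consAt : {A : Set} → A → Fin m → (Fin m → List A) → Fin m → List A
consAt z x h j = if ⌊ x ≟ᶠ j ⌋ then z ∷ h j else h j

consAt-suc : {A : Set} (z : A) (x j : Fin m) (h : Fin (suc m) → List A) →
             consAt z (suc x) h (suc j) ≡ consAt z x (h ∘ suc) j
consAt-suc z x j h = cong (λ b → if b then z ∷ h (suc j) else h (suc j))
  (reflects-⇔ (isYes-reflects (Fin.suc x ≟ᶠ suc j)) (isYes-reflects (x ≟ᶠ j)) Finₚ.suc-injective (cong suc))

-- The index `inject₁ y` places the singleton immediately before the old block `y`, which moves to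
-- `suc y`; after concatenation the boundary between the two is invisible.
cat-newBlock : {A : Set} {z : A} (y : Fin m) {h : Fin m → List A} {h′ : Fin (suc m) → List A} →
               h′ (inject₁ y) ≡ z ∷ [] → (∀ j → h′ (punchIn (inject₁ y) j) ≡ h j) →
               cat (suc m) h′ ≡ cat m (consAt z y h)
cat-newBlock {m = suc m} {z = z} zero {h} e e′ rewrite e =
  cong (z ∷_) (cat-cong (suc m) e′)
cat-newBlock {m = suc m} {z = z} (suc y) {h} {h′} e e′ = cong₂ _++_ (e′ zero) (≡.trans
  (cat-newBlock y {h ∘ suc} {h′ ∘ suc} e (e′ ∘ suc))
  (≡.sym (cat-cong m (λ j → consAt-suc z y j h))))

cat-newLast : {A : Set} {z : A} {h : Fin m → List A} {h′ : Fin (suc m) → List A} →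
              h′ (Fin.fromℕ m) ≡ z ∷ [] → (∀ j → h′ (punchIn (Fin.fromℕ m) j) ≡ h j) →
              cat (suc m) h′ ≡ cat m h ++ z ∷ []
cat-newLast {m = zero}  e e′ rewrite e = ≡.refl
cat-newLast {m = suc m} {h = h} {h′} e e′ = ≡.trans
  (cong₂ _++_ (e′ zero) (cat-newLast {m = m} {h = h ∘ suc} {h′ = h′ ∘ suc} e (e′ ∘ suc)))
  (≡.sym (Listₚ.++-assoc (h zero) _ _))

allFin-suc : ∀ n → allFin (suc n) ≡ zero ∷ map suc (allFin n)
allFin-suc n = cong (zero ∷_) (≡.sym (Listₚ.map-tabulate id suc))

filter-map-suc : (g : Fin (suc n) → Fin m) (j : Fin m) → ∀ C →
                 filter (λ i → g i ≟ᶠ j) (map suc C) ≡ map suc (filter (λ i → g (suc i) ≟ᶠ j) C)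
filter-map-suc g j []      = ≡.refl
filter-map-suc g j (x ∷ C) with g (suc x) ≟ᶠ j
... | yes _ = cong (suc x ∷_) (filter-map-suc g j C)
... | no  _ = filter-map-suc g j C

-- The letter 0 comes first in `allFin`, so a stable sort leaves it at the front of its block.
sort-suc : (g : Fin (suc n) → Fin m) → sort g (allFin (suc n)) ≡
           cat m (consAt zero (g zero) (λ j → map suc (filter (λ i → g (suc i) ≟ᶠ j) (allFin n))))
sort-suc {n} {m} g = ≡.trans (cong (sort g) (allFin-suc n)) (cat-cong m pointwise)
  where
  pointwise : ∀ j → filter (λ i → g i ≟ᶠ j) (zero ∷ map suc (allFin n)) ≡
              consAt zero (g zero) (λ j → map suc (filter (λ i → g (suc i) ≟ᶠ j) (allFin n))) j
  pointwise j with g zero ≟ᶠ j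
  ... | yes _ = cong (zero ∷_) (filter-map-suc g j (allFin n))
  ... | no  _ = filter-map-suc g j (allFin n)

module _ (x : Fin (suc m)) (f : Vec (Fin m) n) where
  private
    f′ = Vec.map (punchIn x) f
    blocks : Fin m → List (Fin (suc n))
    blocks j = map suc (filter (λ i → lookup f i ≟ᶠ j) (allFin n))
    blocks′ : Fin (suc m) → List (Fin (suc n))
    blocks′ = consAt zero x (λ j → map suc (filter (λ i → lookup f′ i ≟ᶠ j) (allFin n)))

    at-new : blocks′ x ≡ zero ∷ []
    at-new rewrite reflects-true (isYes-reflects (x ≟ᶠ x)) ≡.refl =
      cong (λ l → zero ∷ map suc l) (filter-none (λ i → lookup f′ i ≟ᶠ x) {allFin n} (All.tabulate λ {i} _ e →
        Finₚ.punchInᵢ≢i x (lookup f i) (≡.trans (≡.sym (Vecₚ.lookup-map i (punchIn x) f)) e)))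

    at-old : ∀ j → blocks′ (punchIn x j) ≡ blocks j
    at-old j rewrite missB-punchIn x j = cong (map suc) (filter-≐ (λ i → lookup f′ i ≟ᶠ punchIn x j) (λ i → lookup f i ≟ᶠ j)
      ( (λ {i} e → Finₚ.punchIn-injective x _ _ (≡.trans (≡.sym (Vecₚ.lookup-map i (punchIn x) f)) e))
      , (λ {i} e → ≡.trans (Vecₚ.lookup-map i (punchIn x) f) (cong (punchIn x) e))) (allFin n))

  T-newBlock : ∀ y → x ≡ inject₁ y → T (suc m , x ∷ f′) (allFin (suc n)) ≡ T (m , y ∷ f) (allFin (suc n))
  T-newBlock y ≡.refl = ≡.trans (sort-suc (lookup (x ∷ f′)))
    (≡.trans (cat-newBlock y {blocks} {blocks′} at-new at-old) (≡.sym (sort-suc (lookup (y ∷ f)))))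

  T-newLast : x ≡ Fin.fromℕ m → T (suc m , x ∷ f′) (allFin (suc n)) ≡ map suc (T (m , f) (allFin n)) ++ zero ∷ []
  T-newLast ≡.refl = ≡.trans (sort-suc (lookup (x ∷ f′)))
    (≡.trans (cat-newLast {h = blocks} {blocks′} at-new at-old) (cong (_++ zero ∷ []) (≡.sym (cat-map m suc _))))

-- Reversal as a signed sum of sorts

module Reversal {c ℓ} (R : CommutativeRing c ℓ) where
  open CommutativeRing R hiding (zero)
  open InRing R
  open Sums R
  open SetoidReasoning setoid

  -- Setting apart the letter 0: putting it at the front of a block or in a new
  -- block just before that block gives the same word with opposite signs, so
  -- only the words with 0 in a new last block survive.
  signed-sum-T : ∀ n (ψ : List (Fin n) → Carrier) →
                 Σ[ setComps n ] (λ G → sign (n ∸ len G) * ψ (T G (allFin n))) ≈ ψ (reverse (allFin n))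
  signed-sum-T zero    ψ = trans (+-identityʳ _) (*-identityˡ _)
  signed-sum-T (suc n) ψ = begin
    Σ[ setComps (suc n) ] (λ G → sign (suc n ∸ len G) * ψ (T G ids₊))
      ≈⟨ Σ-setComps (suc n) _ ⟩
    Σ[ upTo (suc (suc n)) ] (λ m → Σ-surj (suc n) m (λ f → sign (suc n ∸ m) * ψ (T (m , f) ids₊)))
      ≈⟨ Σ-cong (upTo (suc (suc n))) (λ m → Σ-surj-*ˡ (suc n) m _ _) ⟩
    Σ[ upTo (suc (suc n)) ] (λ m → sign (suc n ∸ m) * Σ-surj (suc n) m (λ f → ψ (T (m , f) ids₊)))
      ≈⟨ Σ-upTo-suc (suc n) _ ⟩
    sign (suc n) * Σ-surj (suc n) 0 (λ f → ψ (T (0 , f) ids₊)) +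
      Σ[ upTo (suc n) ] (λ m → sign (n ∸ m) * Σ-surj (suc n) (suc m) (λ f → ψ (T (suc m , f) ids₊)))
      -- There is no vector of positive length over zero labels, so the sum for m = 0 computes to
      -- zero.
      ≈⟨ trans (+-congʳ (zeroʳ _)) (+-identityˡ _) ⟩
    Σ[ upTo (suc n) ] (λ m → sign (n ∸ m) * Σ-surj (suc n) (suc m) (λ f → ψ (T (suc m , f) ids₊)))
      ≈⟨ Σ-cong (upTo (suc n)) (λ m → trans (*-congˡ (step m)) (distribˡ _ _ _)) ⟩
    Σ[ upTo (suc n) ] (λ m → sign (n ∸ m) * (u (suc m) + u m) + sign (n ∸ m) * d m)
      ≈⟨ Σ-+ (upTo (suc n)) _ _ ⟩
    Σ[ upTo (suc n) ] (λ m → sign (n ∸ m) * (u (suc m) + u m)) + Σ[ upTo (suc n) ] (λ m → sign (n ∸ m) * d m)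
      ≈⟨ +-congʳ (telescope n u) ⟩
    (u (suc n) + sign n * 0#) + Σ[ upTo (suc n) ] (λ m → sign (n ∸ m) * d m)
      -- Both ends of the telescope vanish: n letters cannot fill n + 1 blocks, and `u 0` offers no
      -- block to choose.
      ≈⟨ +-congʳ (+-cong (Σ-0 (allFin (suc n)) (λ _ → Σ-surj-> n (suc n) _ (ℕₚ.n<1+n n))) (zeroʳ _)) ⟩
    (0# + 0#) + Σ[ upTo (suc n) ] (λ m → sign (n ∸ m) * d m)
      ≈⟨ trans (+-congʳ (+-identityˡ _)) (+-identityˡ _) ⟩
    Σ[ upTo (suc n) ] (λ m → sign (n ∸ m) * d m)
      ≈⟨ Σ-cong (upTo (suc n)) (λ m → sym (Σ-surj-*ˡ n m _ _)) ⟩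
    Σ[ upTo (suc n) ] (λ m → Σ-surj n m (λ f → sign (n ∸ m) * ψ′ (T (m , f) (allFin n))))
      ≈⟨ Σ-setComps n (λ G → sign (n ∸ len G) * ψ′ (T G (allFin n))) ⟨
    Σ[ setComps n ] (λ G → sign (n ∸ len G) * ψ′ (T G (allFin n)))
      ≈⟨ signed-sum-T n ψ′ ⟩
    ψ (map suc (reverse (allFin n)) ++ zero ∷ [])
      ≈⟨ reflexive (cong ψ reverse-allFin-suc) ⟩
    ψ (reverse ids₊) ∎
    where
    ids₊ = allFin (suc n)

    ψ′ : List (Fin n) → Carrier
    ψ′ C = ψ (map suc C ++ zero ∷ [])

    u d : ℕ → Carrier
    u m = Σ[ allFin m ] (λ x → Σ-surj n m (λ f → ψ (T (m , x ∷ f) ids₊)))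
    d m = Σ-surj n m (λ f → ψ′ (T (m , f) (allFin n)))

    Σ-surj-*ˡ : ∀ n m a (h : Vec (Fin m) n → Carrier) → Σ-surj n m (λ f → a * h f) ≈ a * Σ-surj n m h
    Σ-surj-*ˡ n m a h = trans (Σ-cong (allVecs n m) pull) (Σ-*ˡ (allVecs n m) a _)
      where
      pull : ∀ f → (if isSurjB f then a * h f else 0#) ≈ a * (if isSurjB f then h f else 0#)
      pull f with isSurjB f
      ... | true  = refl
      ... | false = sym (zeroʳ a)

    step : ∀ m → Σ-surj (suc n) (suc m) (λ f → ψ (T (suc m , f) ids₊)) ≈ (u (suc m) + u m) + d m
    step m = begin
      Σ-surj (suc n) (suc m) (λ f → ψ (T (suc m , f) ids₊))
        ≈⟨ Σ-surj-suc n m _ ⟩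
      u (suc m) + Σ[ allFin (suc m) ] (λ x → Σ-surj n m (λ f → ψ (T (suc m , x ∷ Vec.map (punchIn x) f) ids₊)))
        ≈⟨ +-congˡ (Σ-allFin-last m _) ⟩
      u (suc m) + (Σ-surj n m (λ f → ψ (T (suc m , Fin.fromℕ m ∷ Vec.map (punchIn (Fin.fromℕ m)) f) ids₊)) +
        Σ[ allFin m ] (λ y → Σ-surj n m (λ f → ψ (T (suc m , inject₁ y ∷ Vec.map (punchIn (inject₁ y)) f) ids₊))))
        ≈⟨ +-congˡ (+-cong (Σ-surj-cong n m (λ f → reflexive (cong ψ (T-newLast (Fin.fromℕ m) f ≡.refl))))
             (Σ-cong (allFin m) (λ y → Σ-surj-cong n m (λ f → reflexive (cong ψ (T-newBlock (inject₁ y) f y ≡.refl)))))) ⟩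
      u (suc m) + (d m + u m)
        ≈⟨ +-congˡ (+-comm _ _) ⟩
      u (suc m) + (u m + d m)
        ≈⟨ +-assoc _ _ _ ⟨
      (u (suc m) + u m) + d m ∎

    reverse-allFin-suc : map suc (reverse (allFin n)) ++ zero ∷ [] ≡ reverse ids₊
    reverse-allFin-suc = ≡.sym (≡.trans (cong reverse (allFin-suc n)) (≡.trans
      (Listₚ.unfold-reverse zero (map suc (allFin n)))
      (cong (_++ zero ∷ []) (≡.sym (Listₚ.reverse-map suc (allFin n))))))

-- Words, permutations and change of letters

IsWord : List (Fin n) → Set
IsWord {n} C = C ↭ allFin n

word-T : (F : SetCompCode n) {C : List (Fin n)} → IsWord C → IsWord (T F C)
word-T (m , f) w = ↭-trans (sort-↭ (lookup f) _) w

word-reverse : {C : List (Fin n)} → IsWord C → IsWord (reverse C)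
word-reverse {C = C} w = ↭-trans (Permₚ.↭-reverse C) w

word-unique : {C : List (Fin n)} → IsWord C → Unique≡ C
word-unique {n} C-word = SetoidPermₚ.Unique-resp-↭ (≡.setoid (Fin n)) (Perm.↭⇒↭ₛ (↭-sym C-word)) (Uniqueₚ.allFin⁺ n)

toList-lookup : (v : Vec A k) → toList v ≡ map (lookup v) (allFin k)
toList-lookup {k = zero}  []      = ≡.refl
toList-lookup {k = suc k} (x ∷ v) = cong (x ∷_) (≡.trans (toList-lookup v)
  (≡.trans (Listₚ.map-∘ (allFin k)) (cong (map (lookup (x ∷ v))) (Listₚ.map-tabulate id suc))))

lookup-∈ : (v : Vec A k) (i : Fin k) → lookup v i ∈≡ toList v
lookup-∈ (x ∷ v) zero    = here ≡.refl
lookup-∈ (x ∷ v) (suc i) = there (lookup-∈ v i)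

unique⇒injective : (v : Vec A k) → Unique≡ (toList v) → ∀ i j → lookup v i ≡ lookup v j → i ≡ j
unique⇒injective (x ∷ v) (x∉ ∷ v!) zero    zero    e = ≡.refl
unique⇒injective (x ∷ v) (x∉ ∷ v!) zero    (suc j) e = contradiction e (All.lookup x∉ (lookup-∈ v j))
unique⇒injective (x ∷ v) (x∉ ∷ v!) (suc i) zero    e = contradiction (≡.sym e) (All.lookup x∉ (lookup-∈ v i))
unique⇒injective (x ∷ v) (x∉ ∷ v!) (suc i) (suc j) e = cong suc (unique⇒injective v v! i j e)

fromList-of-length : (C : List A) → List.length C ≡ k → ∃ λ (v : Vec A k) → toList v ≡ C
fromList-of-length C ≡.refl = Vec.fromList C , Vecₚ.toList∘fromList C

word⇒perm : {C : List (Fin n)} → IsWord C → ∃ λ (t : Perm n) → IsInjective t × toList t ≡ C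
word⇒perm {n} {C} w with fromList-of-length C (≡.trans (Permₚ.↭-length w) (Listₚ.length-tabulate id))
... | t , e = t , unique⇒injective t (subst Unique≡ (≡.sym e) (word-unique w)) , e

code-injective : {f g : Vec (Fin m) n} → _≡_ {A = SetCompCode n} (m , f) (m , g) → f ≡ g
code-injective ≡.refl = ≡.refl

-- Pullback of a set composition along a map of letters. It serves twice: along a permutation it is
-- the action on set compositions, and along the labelling of F it turns a set composition of the
-- blocks of F into a coarsening of F.
relabel : Vec (Fin n) m → SetCompCode n → SetCompCode m
relabel t (k , g) = k , tabulate (λ i → lookup g (lookup t i))

relabel-isSetComp : (t : Vec (Fin n) m) (G : SetCompCode n) → IsSetComp (n , t) → IsSetComp G → IsSetComp (relabel t G)
relabel-isSetComp t (k , g) s r b with r b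
... | i , e with s i
...   | j , e′ = j , ≡.trans (Vecₚ.lookup∘tabulate _ j) (≡.trans (cong (lookup g) e′) e)

relabel-injective : (t : Vec (Fin n) m) → IsSetComp (n , t) → ∀ {G H} → relabel t G ≡ relabel t H → G ≡ H
relabel-injective t s {k , g} {k′ , h} e with cong proj₁ e
... | ≡.refl = cong (k ,_) (≡.trans (≡.sym (Vecₚ.tabulate∘lookup g)) (≡.trans (Vecₚ.tabulate-cong pointwise) (Vecₚ.tabulate∘lookup h)))
  where
  same : tabulate (λ i → lookup g (lookup t i)) ≡ tabulate (λ i → lookup h (lookup t i))
  same = code-injective e
  pointwise : ∀ i → lookup g i ≡ lookup h i
  pointwise i with s i
  ... | j , ≡.refl = ≡.trans (≡.sym (Vecₚ.lookup∘tabulate _ j)) (≡.trans (cong (λ v → lookup v j) same) (Vecₚ.lookup∘tabulate _ j))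

-- G is constant on the blocks of F, so it descends to the set of these blocks; `h` reads it off at
-- the representatives.
⪰⇒relabel : (F@(m , f) G : SetCompCode n) → IsSetComp F → F ⪯ G → IsSetComp G →
            ∃ λ (H : SetCompCode m) → IsSetComp H × G ≡ relabel f H
⪰⇒relabel (m , f) (k , g) s F⪯G r = (k , h) , h-surj , cong (k ,_) (≡.trans (≡.sym (Vecₚ.tabulate∘lookup g)) (Vecₚ.tabulate-cong pointwise))
  where
  h : Vec (Fin k) m
  h = tabulate (λ b → lookup g (proj₁ (s b)))
  pointwise : ∀ i → lookup g i ≡ lookup h (lookup f i)
  pointwise i = ≡.trans (F⪯G _ _ (≡.sym (proj₂ (s (lookup f i))))) (≡.sym (Vecₚ.lookup∘tabulate _ (lookup f i)))
  h-surj : IsSetComp (k , h)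
  h-surj b = lookup f (proj₁ (r b)) , ≡.trans (≡.sym (pointwise (proj₁ (r b)))) (proj₂ (r b))

relabel-⪰ : (F@(m , f) : SetCompCode n) (H : SetCompCode m) → F ⪯ relabel f H
relabel-⪰ (m , f) (k , h) i j e = ≡.trans (Vecₚ.lookup∘tabulate _ i) (≡.trans (cong (lookup h) e) (≡.sym (Vecₚ.lookup∘tabulate _ j)))

T-relabel : (t : Perm n) (G : SetCompCode n) → ∀ C → T G (map (lookup t) C) ≡ map (lookup t) (T (relabel t G) C)
T-relabel t (k , g) C = ≡.trans (sort-equivariant (lookup g) (lookup t) C)
  (cong (map (lookup t)) (sort-cong {f = lookup g ∘ lookup t} (λ i → ≡.sym (Vecₚ.lookup∘tabulate (lookup g ∘ lookup t) i)) C))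

-- Signed sums over all set compositions and over coarsenings

module SignSums {c ℓ} (R : CommutativeRing c ℓ) where
  open CommutativeRing R hiding (zero)
  open InRing R
  open Sums R
  open Reversal R
  open RingProperties ring using (-‿distribˡ-*)
  open SetoidReasoning setoid

  Σ-relabel : (t : Perm n) → IsInjective t → (h : SetCompCode n → Carrier) →
              Σ[ setComps n ] (h ∘ relabel t) ≈ Σ[ setComps n ] h
  Σ-relabel {n} t inj h = Σ-bijection h (setComps-unique n) (setComps-unique n) (relabel t)
    (λ {G} G∈ → ∈-setComps⁺ (relabel-isSetComp t G t-surj (∈-setComps⁻ G∈)))
    (λ _ _ → relabel-injective t t-surj)
    -- A permutation, read as a set composition into singletons, refines every G.
    (λ {G} G∈ → let (H , s , e) = ⪰⇒relabel (n , t) G t-surj (λ i j e → cong (lookup (proj₂ G)) (inj i j e)) (∈-setComps⁻ G∈)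
                in H , ∈-setComps⁺ s , e)
    where
    t-surj = injective⇒surjective t inj

  sign-+ : ∀ a b → sign (a ℕ.+ b) ≈ sign a * sign b
  sign-+ zero    b = sym (*-identityˡ _)
  sign-+ (suc a) b = trans (-‿cong (sign-+ a b)) (-‿distribˡ-* _ _)

  -- Relabelling by a permutation keeps the number of blocks and hence the sign, so the identity at
  -- `allFin n` carries over to every word.
  Σ-sign-word : {C : List (Fin n)} → IsWord C → (ψ : List (Fin n) → Carrier) →
                Σ[ setComps n ] (λ G → sign (n ∸ len G) * ψ (T G C)) ≈ ψ (reverse C)
  Σ-sign-word {n} {C} w ψ with word⇒perm w
  ... | t , inj , e rewrite ≡.sym e = begin
    Σ[ setComps n ] (λ G → sign (n ∸ len G) * ψ (T G (toList t)))
      ≈⟨ Σ-cong (setComps n) (λ G → *-congˡ (reflexive (cong ψ (≡.trans (cong (T G) (toList-lookup t)) (T-relabel t G (allFin n)))))) ⟩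
    Σ[ setComps n ] (λ G → sign (n ∸ len G) * ψ (map (lookup t) (T (relabel t G) (allFin n))))
      ≈⟨ Σ-relabel t inj (λ G → sign (n ∸ len G) * ψ (map (lookup t) (T G (allFin n)))) ⟩
    Σ[ setComps n ] (λ G → sign (n ∸ len G) * ψ (map (lookup t) (T G (allFin n))))
      ≈⟨ signed-sum-T n (ψ ∘ map (lookup t)) ⟩
    ψ (map (lookup t) (reverse (allFin n)))
      ≈⟨ reflexive (cong ψ (≡.trans (Listₚ.reverse-map (lookup t) (allFin n)) (cong reverse (≡.sym (toList-lookup t))))) ⟩
    ψ (reverse (toList t)) ∎

  -- The coarsenings of F are the set compositions of its m blocks. Their signs factor through
  -- `sign (n ∸ m)`, and the remaining signed count is `signed-sum-T` for the constant function 1.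
  -- This yields the diagonal entry of reversal at F.
  Σ-sign-⪰ : (F : SetCompCode n) → IsSetComp F →
             Σ[ setComps n ] (λ G → if refinesB F G then sign (n ∸ len G) else 0#) ≈ sign (n ∸ len F)
  Σ-sign-⪰ {n} F@(m , f) s = begin
    Σ[ setComps n ] (λ G → if refinesB F G then sign (n ∸ len G) else 0#)
      ≈⟨ Σ-filter (refinesB F) (setComps n) (λ G → sign (n ∸ len G)) ⟨
    Σ[ coarser ] (λ G → sign (n ∸ len G))
      ≈⟨ Σ-bijection (λ G → sign (n ∸ len G)) (setComps-unique m) (Uniqueₚ.filter⁺ _ (setComps-unique n)) (relabel f)
           (λ {H} H∈ → ∈-filter⁺ _ (∈-setComps⁺ (relabel-isSetComp f H s (∈-setComps⁻ H∈)))
                                   (reflects-true (refinesB-reflects F (relabel f H)) (relabel-⪰ F H)))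
           (λ _ _ → relabel-injective f s)
           onto ⟨
    Σ[ setComps m ] (λ H → sign (n ∸ len H))
      ≈⟨ Σ-cong-∈ (setComps m) (λ {H} H∈ → trans
           (trans (reflexive (cong sign (lengths (len≤n H (∈-setComps⁻ H∈))))) (sign-+ (n ∸ m) (m ∸ len H)))
           (*-congˡ (sym (*-identityʳ _)))) ⟩
    Σ[ setComps m ] (λ H → sign (n ∸ m) * (sign (m ∸ len H) * 1#))
      ≈⟨ Σ-*ˡ (setComps m) _ _ ⟩
    sign (n ∸ m) * Σ[ setComps m ] (λ H → sign (m ∸ len H) * 1#)
      ≈⟨ *-congˡ (signed-sum-T m (λ _ → 1#)) ⟩
    sign (n ∸ m) * 1#
      ≈⟨ *-identityʳ _ ⟩
    sign (n ∸ m) ∎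
    where
    coarser : List (SetCompCode n)
    coarser = filter (λ G → refinesB F G ≟B true) (setComps n)
    lengths : ∀ {l} → l ℕ.≤ m → n ∸ l ≡ (n ∸ m) ℕ.+ (m ∸ l)
    lengths {l} l≤m = ≡.trans (cong (_∸ l) (≡.sym (ℕₚ.m∸n+n≡m (len≤n F s)))) (ℕₚ.+-∸-assoc (n ∸ m) l≤m)
    onto : ∀ {G} → G ∈≡ coarser → ∃ λ H → H ∈≡ setComps m × G ≡ relabel f H
    onto {G} G∈ =
      let (G∈′ , b) = ∈-filter⁻ _ {xs = setComps n} G∈
          (H , r , e) = ⪰⇒relabel F G s (true-reflects (refinesB-reflects F G) b) (∈-setComps⁻ G∈′)
      in H , ∈-setComps⁺ r , e

-- Consequences of the order on the ring

module OrderedRing {c ℓ ℓ₂} (K : OrderedCommRing c ℓ ℓ₂) where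
  open OrderedCommRing K hiding (zero)
  open InRing commutativeRing
  open Sums commutativeRing
  open RingProperties ring using (-‿distribˡ-*; -‿distribʳ-*; -‿involutive; -‿injective; -0#≈0#; +-cancelˡ; -1*x≈-x)
  open IsTotalOrder isTotalOrder public using (total; antisym; ≤-respˡ-≈; ≤-respʳ-≈) renaming (trans to ≤-trans; refl to ≤-refl)

  +-mono₂-≤ : ∀ {a b c d} → a ≤ b → c ≤ d → (a + c) ≤ (b + d)
  +-mono₂-≤ {a} {b} {c} {d} p q = ≤-trans (+-mono-≤ c p)
    (≤-respˡ-≈ (+-comm c b) (≤-respʳ-≈ (+-comm d b) (+-mono-≤ b q)))

  ≤-negate : ∀ {a} → 0# ≤ a → (- a) ≤ 0#
  ≤-negate {a} p = ≤-respˡ-≈ (+-identityˡ _) (≤-respʳ-≈ (-‿inverseʳ a) (+-mono-≤ (- a) p))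

  +-cancelʳ-≤ : ∀ {a b} c → (a + c) ≤ (b + c) → a ≤ b
  +-cancelʳ-≤ {a} {b} c p = ≤-respˡ-≈ (undo a) (≤-respʳ-≈ (undo b) (+-mono-≤ (- c) p))
    where
    undo : ∀ x → (x + c) + - c ≈ x
    undo x = trans (+-assoc _ _ _) (trans (+-congˡ (-‿inverseʳ c)) (+-identityʳ x))

  x≈-x⇒x≈0 : ∀ {x} → x ≈ - x → x ≈ 0#
  x≈-x⇒x≈0 {x} e with total 0# x
  ... | inj₁ 0≤x = antisym (≤-respˡ-≈ (sym e) (≤-negate 0≤x)) 0≤x
  ... | inj₂ x≤0 = antisym x≤0 (≤-respʳ-≈ (sym e) (≤-respˡ-≈ (-‿inverseʳ x) (≤-respʳ-≈ (+-identityˡ _) (+-mono-≤ (- x) x≤0))))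

  x≈-y⇒x≈y : ∀ {x y} → 0# ≤ x → 0# ≤ y → x ≈ - y → x ≈ y
  x≈-y⇒x≈y {x} {y} 0≤x 0≤y e = trans x≈0 (sym y≈0)
    where
    x≈0 : x ≈ 0#
    x≈0 = antisym (≤-respˡ-≈ (sym e) (≤-negate 0≤y)) 0≤x
    y≈0 : y ≈ 0#
    y≈0 = trans (sym (-‿involutive y)) (trans (-‿cong (trans (sym e) x≈0)) -0#≈0#)

  sign-cases : ∀ d → sign d ≈ 1# ⊎ sign d ≈ - 1#
  sign-cases zero    = inj₁ refl
  sign-cases (suc d) with sign-cases d
  ... | inj₁ e = inj₂ (-‿cong e)
  ... | inj₂ e = inj₁ (trans (-‿cong e) (-‿involutive 1#))

  sign-square : ∀ d → sign d * sign d ≈ 1#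
  sign-square zero    = *-identityˡ 1#
  sign-square (suc d) = trans (sym (-‿distribˡ-* _ _)) (trans (-‿cong (sym (-‿distribʳ-* _ _)))
    (trans (-‿involutive _) (sign-square d)))

  -- Equal signs cancel. With opposite signs each number is the negative of the other, and
  -- nonnegativity makes both zero. So a coincidence of signed eigenvalues is a coincidence of the
  -- unsigned ones.
  signed-nonneg-injective : ∀ d e {x y} → 0# ≤ x → 0# ≤ y → sign d * x ≈ sign e * y → x ≈ y
  signed-nonneg-injective d e {x} {y} 0≤x 0≤y eq with sign-cases d | sign-cases e
  ... | inj₁ p | inj₁ q = trans (sym (trans (*-congʳ p) (*-identityˡ x))) (trans eq (trans (*-congʳ q) (*-identityˡ y)))
  ... | inj₂ p | inj₂ q = -‿injective (trans (sym (trans (*-congʳ p) (-1*x≈-x x))) (trans eq (trans (*-congʳ q) (-1*x≈-x y))))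
  ... | inj₁ p | inj₂ q = x≈-y⇒x≈y 0≤x 0≤y (trans (sym (trans (*-congʳ p) (*-identityˡ x))) (trans eq (trans (*-congʳ q) (-1*x≈-x y))))
  ... | inj₂ p | inj₁ q = sym (x≈-y⇒x≈y 0≤y 0≤x (trans (sym (trans (*-congʳ q) (*-identityˡ y))) (trans (sym eq) (trans (*-congʳ p) (-1*x≈-x x)))))

  Σ-mono-≤ : ∀ (xs : List I) {h h′ : I → Carrier} → (∀ x → h x ≤ h′ x) → (Σ[ xs ] h) ≤ (Σ[ xs ] h′)
  Σ-mono-≤ []       p = ≤-refl
  Σ-mono-≤ (x ∷ xs) p = +-mono₂-≤ (p x) (Σ-mono-≤ xs p)

  Σ-nonneg : ∀ (xs : List I) {h : I → Carrier} → (∀ {x} → x ∈≡ xs → 0# ≤ h x) → 0# ≤ (Σ[ xs ] h)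
  Σ-nonneg []       p = ≤-refl
  Σ-nonneg (x ∷ xs) p = ≤-respˡ-≈ (+-identityˡ 0#) (+-mono₂-≤ (p (here ≡.refl)) (Σ-nonneg xs (p ∘ there)))

  -- Slack in one term cannot be made up by another, since all the inequalities point the same way.
  Σ-≤-tight : ∀ (xs : List I) {h h′ : I → Carrier} → (∀ x → h x ≤ h′ x) → (Σ[ xs ] h) ≈ (Σ[ xs ] h′) →
              ∀ {x} → x ∈≡ xs → h x ≈ h′ x
  Σ-≤-tight (y ∷ xs) {h} {h′} p e = go
    where
    head : h y ≈ h′ y
    head = antisym (p y) (+-cancelʳ-≤ (Σ[ xs ] h)
      (≤-respʳ-≈ (sym e) (+-mono₂-≤ (≤-refl {h′ y}) (Σ-mono-≤ xs p))))
    go : ∀ {x} → x ∈≡ y ∷ xs → h x ≈ h′ x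
    go (here ≡.refl) = head
    go (there x∈)    = Σ-≤-tight xs p (+-cancelˡ (h y) _ _ (trans e (+-congʳ (sym head)))) x∈

-- Triangularity and the annihilating product

module Spectrum {c ℓ ℓ₂} (K : OrderedCommRing c ℓ ℓ₂) (n : ℕ)
  (w : SetCompCode n → OrderedCommRing.Carrier K)
  (w-nonneg : ∀ G → OrderedCommRing._≤_ K (OrderedCommRing.0# K) (w G)) where
  open OrderedCommRing K hiding (zero)
  open InRing commutativeRing
  open Sums commutativeRing
  open SignSums commutativeRing
  open OrderedRing K
  open RingProperties ring using (-‿distribˡ-*; -‿distribʳ-*; -‿involutive; -‿+-comm)
  open SetoidReasoning setoid
  open SetoidMembership setoid using (_∈_)

  Fn : Set c
  Fn = List (Fin n) → Carrier

  infix 4 _≋_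
  -- Functions are compared on words alone because `Σ-sign-word` expands the reversal of words, not
  -- of arbitrary lists.
  _≋_ : Fn → Fn → Set ℓ
  φ ≋ ψ = ∀ C → IsWord C → φ C ≈ ψ C

  infixl 6 _⊞_
  infixr 7 _⊡_
  _⊞_ : Fn → Fn → Fn
  (φ ⊞ ψ) C = φ C + ψ C

  _⊡_ : Carrier → Fn → Fn
  (a ⊡ φ) C = a * φ C

  0ᶠ : Fn
  0ᶠ _ = 0#

  combination : {I : Set} → List I → (I → Carrier) → (I → Fn) → Fn
  combination xs a φ C = Σ[ xs ] (λ x → a x * φ x C)

  record Linear (Q : Fn → Fn) : Set (c Level.⊔ ℓ) where
    field
      cong-≋ : ∀ {φ ψ} → φ ≋ ψ → Q φ ≋ Q ψ
      add    : ∀ φ ψ → Q (φ ⊞ ψ) ≋ Q φ ⊞ Q ψ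
      scale  : ∀ a φ → Q (a ⊡ φ) ≋ a ⊡ Q φ

    zero-≋ : Q 0ᶠ ≋ 0ᶠ
    zero-≋ C C-word = begin
      Q 0ᶠ C          ≈⟨ cong-≋ (λ _ _ → sym (zeroˡ 0#)) C C-word ⟩
      Q (0# ⊡ 0ᶠ) C   ≈⟨ scale 0# 0ᶠ C C-word ⟩
      0# * Q 0ᶠ C     ≈⟨ zeroˡ _ ⟩
      0# ∎

    combine-≋ : {I : Set} (xs : List I) (a : I → Carrier) (φ : I → Fn) →
                Q (combination xs a φ) ≋ combination xs a (Q ∘ φ)
    combine-≋ []       a φ = zero-≋
    combine-≋ (x ∷ xs) a φ C C-word = trans (add (a x ⊡ φ x) (combination xs a φ) C C-word)
      (+-cong (scale (a x) (φ x) C C-word) (combine-≋ xs a φ C C-word))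

  open Linear

  ∘-linear : ∀ {Q Q′} → Linear Q → Linear Q′ → Linear (Q ∘ Q′)
  ∘-linear l l′ .cong-≋ e = cong-≋ l (cong-≋ l′ e)
  ∘-linear l l′ .add φ ψ C C-word = trans (cong-≋ l (add l′ φ ψ) C C-word) (add l _ _ C C-word)
  ∘-linear l l′ .scale a φ C C-word = trans (cong-≋ l (scale l′ a φ) C C-word) (scale l _ _ C C-word)

  -- Pullbacks: `Z φ` at `C` evaluates `φ` at the words obtained by first sorting `C` and then
  -- reversing. For the weights coming from γ this is right multiplication by B_γ and then by w₀.
  X rev Z : Fn → Fn
  X φ C = Σ[ setComps n ] (λ G → w G * φ (T G C))
  rev φ C = φ (reverse C)
  Z φ   = X (rev φ)

  X-linear : Linear X
  X-linear .cong-≋ e C C-word = Σ-cong (setComps n) (λ G → *-congˡ (e (T G C) (word-T G C-word)))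
  X-linear .add φ ψ C C-word = trans (Σ-cong (setComps n) (λ G → distribˡ _ _ _)) (Σ-+ (setComps n) _ _)
  X-linear .scale a φ C C-word = trans (Σ-cong (setComps n) (λ G → *-swap _ _ _)) (Σ-*ˡ (setComps n) a _)

  rev-linear : Linear rev
  rev-linear .cong-≋ e C C-word = e (reverse C) (word-reverse C-word)
  rev-linear .add φ ψ C C-word = refl
  rev-linear .scale a φ C C-word = refl

  Z-linear : Linear Z
  Z-linear = ∘-linear X-linear rev-linear

  step : Carrier → Fn → Fn
  step k φ = Z φ ⊞ (- k) ⊡ φ

  step-linear : ∀ k → Linear (step k)
  step-linear k .cong-≋ e C C-word = +-cong (cong-≋ Z-linear e C C-word) (*-congˡ (e C C-word))
  step-linear k .add φ ψ C C-word = trans (+-cong (add Z-linear φ ψ C C-word) (distribˡ _ _ _)) (+-interchange _ _ _ _)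
  step-linear k .scale a φ C C-word = trans (+-cong (scale Z-linear a φ C C-word) (*-swap _ _ _)) (sym (distribˡ a _ _))

  step-cong : ∀ {k l} → k ≈ l → ∀ φ → step k φ ≋ step l φ
  step-cong e φ C C-word = +-congˡ (*-congʳ (-‿cong e))

  step-comm : ∀ k l φ → step k (step l φ) ≋ step l (step k φ)
  step-comm k l φ C C-word = begin
    step k (step l φ) C
      ≈⟨ expand k l ⟩
    (Z (Z φ) C + (- l) * Z φ C) + ((- k) * Z φ C + (- k) * ((- l) * φ C))
      ≈⟨ +-interchange _ _ _ _ ⟩
    (Z (Z φ) C + (- k) * Z φ C) + ((- l) * Z φ C + (- k) * ((- l) * φ C))
      ≈⟨ +-congˡ (+-congˡ (*-swap _ _ _)) ⟩
    (Z (Z φ) C + (- k) * Z φ C) + ((- l) * Z φ C + (- l) * ((- k) * φ C))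
      ≈⟨ expand l k ⟨
    step l (step k φ) C ∎
    where
    expand : ∀ k l → step k (step l φ) C ≈ (Z (Z φ) C + (- l) * Z φ C) + ((- k) * Z φ C + (- k) * ((- l) * φ C))
    expand k l = +-cong (trans (add Z-linear (Z φ) ((- l) ⊡ φ) C C-word) (+-congˡ (scale Z-linear (- l) φ C C-word)))
                        (distribˡ _ _ _)

  P : List Carrier → Fn → Fn
  P []       φ = φ
  P (k ∷ ks) φ = step k (P ks φ)

  P-linear : ∀ ks → Linear (P ks)
  P-linear []       = record { cong-≋ = λ e → e ; add = λ _ _ _ _ → refl ; scale = λ _ _ _ _ → refl }
  P-linear (k ∷ ks) = ∘-linear (step-linear k) (P-linear ks)

  P-step : ∀ ks k φ → P ks (step k φ) ≋ step k (P ks φ)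
  P-step []       k φ C C-word = refl
  P-step (l ∷ ks) k φ C C-word = trans (cong-≋ (step-linear l) (P-step ks k φ) C C-word) (step-comm l k (P ks φ) C C-word)

  -- The factors commute, so one belonging to `k` can be moved innermost, where it acts first. Only
  -- entries equal to `k` can get lost on the way.
  remove : ∀ {ks k} → k ∈ ks →
           ∃ λ ks′ → (∀ φ → P ks φ ≋ P ks′ (step k φ)) × (∀ {l} → l ∈ ks → ¬ l ≈ k → l ∈ ks′)
  remove {k₁ ∷ ks} {k} (here e) = ks , eq , rest
    where
    eq : ∀ φ → P (k₁ ∷ ks) φ ≋ P ks (step k φ)
    eq φ C C-word = trans (step-cong (sym e) (P ks φ) C C-word) (sym (P-step ks k φ C C-word))
    rest : ∀ {l} → l ∈ k₁ ∷ ks → ¬ l ≈ k → l ∈ ks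
    rest (here q)  ne = contradiction (trans q (sym e)) ne
    rest (there q) ne = q
  remove {k₁ ∷ ks} {k} (there k∈) with remove k∈
  ... | ks′ , eq , rest = k₁ ∷ ks′ , (λ φ → cong-≋ (step-linear k₁) (eq φ)) ,
    λ { (here q) _ → here q ; (there q) ne → there (rest q ne) }

  infixl 8 _∘T_
  _∘T_ : Fn → SetCompCode n → Fn
  (φ ∘T F) C = φ (T F C)

  sgn : SetCompCode n → Carrier
  sgn F = sign (n ∸ len F)

  X-∘T : ∀ F φ → X (φ ∘T F) ≋ combination (setComps n) w (λ G → φ ∘T join F G)
  X-∘T F φ C _ = Σ-cong (setComps n) (λ G → *-congˡ (reflexive (cong φ (≡.sym (T-join F G C)))))

  -- The word is reversed before it is sorted by F, so the signed expansion of reversal takes place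
  -- inside `T F`. Every term then belongs to a refinement of F, which makes `rev` triangular.
  rev-∘T : ∀ F φ → rev (φ ∘T F) ≋ combination (setComps n) sgn (λ G → φ ∘T join F G)
  rev-∘T F φ C C-word = trans (sym (Σ-sign-word C-word (φ ∘ T F)))
    (Σ-cong (setComps n) (λ G → *-congˡ (reflexive (cong φ (≡.sym (T-join F G C))))))

  -- The diagonal entry at F of the operator with coefficients `a`: the total weight of those G that
  -- F absorbs.
  mass : (SetCompCode n → Carrier) → SetCompCode n → Carrier
  mass a F = Σ[ setComps n ] (λ G → if refinesB F G then a G else 0#)

  -- The terms with F ⪯ G all carry φ ∘ T F, since T (join F G) = T F there.
  combination-join : ∀ {Q} → Linear Q → ∀ a F → IsSetComp F → ∀ φ C → IsWord C →
    (∀ G → IsSetComp G → ¬ F ⪯ G → a G * Q (φ ∘T join F G) C ≈ 0#) →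
    combination (setComps n) a (λ G → Q (φ ∘T join F G)) C ≈ mass a F * Q (φ ∘T F) C
  combination-join {Q} lin a F F-comp φ C C-word vanish = trans
    (Σ-cong-∈ (setComps n) (λ {G} G∈ → term G (∈-setComps⁻ G∈)))
    (Σ-*ʳ (setComps n) _ _)
    where
    term : ∀ G → IsSetComp G → a G * Q (φ ∘T join F G) C ≈ (if refinesB F G then a G else 0#) * Q (φ ∘T F) C
    term G G-comp with refinesB F G | refinesB-reflects F G
    ... | true  | ofʸ F⪯G = *-congˡ (cong-≋ lin (λ D _ → reflexive (cong φ (≡.trans (T-join F G D) (T-absorb F G F-comp F⪯G D)))) C C-word)
    ... | false | ofⁿ F⋠G = trans (vanish G G-comp F⋠G) (sym (zeroˡ _))

  -- With the weights coming from γ, `lam F` is n_γ(F), and `eig F` below agrees with `ñγ γ F` by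
  -- `ñγ≈`.
  lam : SetCompCode n → Carrier
  lam = mass w

  eig : SetCompCode n → Carrier
  eig F = sgn F * lam F

  mass-sgn : ∀ F → IsSetComp F → mass sgn F ≈ sgn F
  mass-sgn = Σ-sign-⪰

  lam-nonneg : ∀ F → 0# ≤ lam F
  lam-nonneg F = Σ-nonneg (setComps n) (λ {G} _ → term G)
    where
    term : ∀ G → 0# ≤ (if refinesB F G then w G else 0#)
    term G with refinesB F G
    ... | true  = w-nonneg G
    ... | false = ≤-refl

  lam-term-mono : ∀ H F → H ⪯ F → ∀ G → (if refinesB F G then w G else 0#) ≤ (if refinesB H G then w G else 0#)
  lam-term-mono H F H⪯F G with refinesB F G | refinesB-reflects F G | refinesB H G | refinesB-reflects H G
  ... | true  | _       | true  | _       = ≤-refl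
  ... | false | _       | true  | _       = w-nonneg G
  ... | false | _       | false | _       = ≤-refl
  ... | true  | ofʸ F⪯G | false | ofⁿ H⋠G = contradiction (⪯-trans H F G H⪯F F⪯G) H⋠G

  lam-mono : ∀ H F → H ⪯ F → lam F ≤ lam H
  lam-mono H F H⪯F = Σ-mono-≤ (setComps n) (lam-term-mono H F H⪯F)

  -- The weight of such a G enters the sum for H but not the sum for F; equality of the sums leaves
  -- it no room.
  lam-tight : ∀ H F → H ⪯ F → lam F ≈ lam H → ∀ G → IsSetComp G → H ⪯ G → ¬ F ⪯ G → w G ≈ 0#
  lam-tight H F H⪯F e G G-comp H⪯G F⋠G = sym (trans (reflexive (≡.sym atF)) (trans (Σ-≤-tight (setComps n) (lam-term-mono H F H⪯F) e (∈-setComps⁺ G-comp)) (reflexive atH)))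
    where
    atF : (if refinesB F G then w G else 0#) ≡ 0#
    atF rewrite reflects-false (refinesB-reflects F G) F⋠G = ≡.refl
    atH : (if refinesB H G then w G else 0#) ≡ w G
    atH rewrite reflects-true (refinesB-reflects H G) H⪯G = ≡.refl

  eig≈⇒lam≈ : ∀ F H → eig F ≈ eig H → lam F ≈ lam H
  eig≈⇒lam≈ F H = signed-nonneg-injective (n ∸ len F) (n ∸ len H) (lam-nonneg F) (lam-nonneg H)

  -- Comparisons are requested for eigenvalues only, which is what the list in the theorem can
  -- decide.
  module Annihilation (eig≟ : ∀ F H → IsSetComp F → IsSetComp H → Dec (eig F ≈ eig H)) where

    search : ∀ {p} {Q : SetCompCode n → Set p} → (∀ H → IsSetComp H → Dec (Q H)) → Dec (∃ λ H → IsSetComp H × Q H)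
    search {Q = Q} Q? with Any.any? both? (setComps n)
      where
      both? : ∀ H → Dec (IsSetComp H × Q H)
      both? H with IsSetComp? H
      ... | no ¬s = no (¬s ∘ proj₁)
      ... | yes s with Q? H s
      ...   | yes q = yes (s , q)
      ...   | no ¬q = no (¬q ∘ proj₂)
    ... | yes found = let (H , _ , q) = find found in yes (H , q)
    ... | no ¬found = no λ (H , s , q) → ¬found (lose (∈-setComps⁺ s) (s , q))

    occurs? : ∀ F → IsSetComp F → ∀ H → Dec (∃ λ H′ → IsSetComp H′ × (H′ ⪯ H × eig H′ ≈ eig F))
    occurs? F s H = search dec
      where
      dec : ∀ H′ → IsSetComp H′ → Dec (H′ ⪯ H × eig H′ ≈ eig F)
      dec H′ s′ with H′ ⪯? H | eig≟ H′ F s′ s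
      ... | yes p | yes q = yes (p , q)
      ... | no ¬p | _     = no (¬p ∘ proj₁)
      ... | _     | no ¬q = no (¬q ∘ proj₂)

    -- The inequality of lengths excludes the rearrangements of F itself, which share its
    -- eigenvalue.
    recurs? : ∀ F → IsSetComp F → Dec (∃ λ H → IsSetComp H × (H ⪯ F × len F ℕ.< len H × eig H ≈ eig F))
    recurs? F s = search dec
      where
      dec : ∀ H → IsSetComp H → Dec (H ⪯ F × len F ℕ.< len H × eig H ≈ eig F)
      dec H s′ with H ⪯? F | len F ℕₚ.<? len H | eig≟ H F s′ s
      ... | yes p | yes q | yes r = yes (p , q , r)
      ... | no ¬p | _     | _     = no (¬p ∘ proj₁)
      ... | _     | no ¬q | _     = no (¬q ∘ proj₁ ∘ proj₂)
      ... | _     | _     | no ¬r = no (¬r ∘ proj₂ ∘ proj₂)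

    -- Further values are allowed in the list. Thus the induction hypothesis applies at a finer H
    -- both with the whole list and, when the value of F does not occur below H, with the list from
    -- which it was removed.
    Covers : List Carrier → SetCompCode n → Set (ℓ Level.⊔ c)
    Covers ks F = ∀ H → IsSetComp H → H ⪯ F → eig H ∈ ks

    Kills : (Fn → Fn) → SetCompCode n → Set (ℓ Level.⊔ c)
    Kills Q F = ∀ φ → Q (φ ∘T F) ≋ 0ᶠ

    strict-join : ∀ (F G : SetCompCode n) → IsSetComp F → ¬ F ⪯ G → len F ℕ.< len (join F G)
    strict-join F G s F⋠G = ⪯∧⋠⇒len< (join F G) F G s (join-⪯ˡ F G) (join-⪯ʳ F G) F⋠G

    module Step (F : SetCompCode n) (F-comp : IsSetComp F) (ks : List Carrier) (cov : Covers ks F)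
      (ih : ∀ H → IsSetComp H → len F ℕ.< len H → ∀ ks → Covers ks H → Kills (P ks) H) where

      ks′ : List Carrier
      ks′ = proj₁ (remove (cov F F-comp (⪯-refl F)))

      Q : Fn → Fn
      Q = P ks′

      Q-linear : Linear Q
      Q-linear = P-linear ks′

      QX-linear : Linear (Q ∘ X)
      QX-linear = ∘-linear Q-linear X-linear

      E : Fn → Fn
      E = Q ∘ step (eig F)

      E-linear : Linear E
      E-linear = ∘-linear Q-linear (step-linear (eig F))

      P≋E : ∀ φ → P ks φ ≋ E φ
      P≋E = proj₁ (proj₂ (remove (cov F F-comp (⪯-refl F))))

      covers′ : ∀ H → H ⪯ F → ¬ (∃ λ H′ → IsSetComp H′ × (H′ ⪯ H × eig H′ ≈ eig F)) → Covers ks′ H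
      covers′ H H⪯F none H′ s p =
        proj₂ (proj₂ (remove (cov F F-comp (⪯-refl F)))) (cov H′ s (⪯-trans H′ H F p H⪯F)) (λ e → none (H′ , s , p , e))

      E-expand : ∀ φ C → IsWord C → E φ C ≈ Q (Z φ) C + - eig F * Q φ C
      E-expand φ C C-word = trans (add Q-linear (Z φ) _ C C-word) (+-congˡ (scale Q-linear _ φ C C-word))

      QX-∘T : ∀ H φ C → IsWord C → Q (X (φ ∘T H)) C ≈ combination (setComps n) w (λ G → Q (φ ∘T join H G)) C
      QX-∘T H φ C C-word = trans (cong-≋ Q-linear (X-∘T H φ) C C-word) (combine-≋ Q-linear (setComps n) w _ C C-word)

      linear-rev-∘T : ∀ {Q′} → Linear Q′ → ∀ H φ C → IsWord C →
                    Q′ (rev (φ ∘T H)) C ≈ combination (setComps n) sgn (λ G → Q′ (φ ∘T join H G)) C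
      linear-rev-∘T lin H φ C C-word = trans (cong-≋ lin (rev-∘T H φ) C C-word) (combine-≋ lin (setComps n) sgn _ C C-word)

      combination-sgn : ∀ {Q′} → Linear Q′ → ∀ φ C → IsWord C →
        (∀ G → ¬ F ⪯ G → Q′ (φ ∘T join F G) C ≈ 0#) →
        combination (setComps n) sgn (λ G → Q′ (φ ∘T join F G)) C ≈ sgn F * Q′ (φ ∘T F) C
      combination-sgn lin φ C C-word vanish = trans
        (combination-join lin sgn F F-comp φ C C-word (λ G _ F⋠G → trans (*-congˡ (vanish G F⋠G)) (zeroʳ _)))
        (*-congʳ (mass-sgn F F-comp))

      -- The remaining factors `Q` already kill everything strictly finer than F. Only the diagonal
      -- term of `Z` survives, and the factor for `eig F` cancels it.
      module NotRecurring (none : ¬ (∃ λ H → IsSetComp H × (H ⪯ F × len F ℕ.< len H × eig H ≈ eig F))) where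

        Q-kills : ∀ H → IsSetComp H → H ⪯ F → len F ℕ.< len H → Kills Q H
        Q-kills H s H⪯F F<H = ih H s F<H ks′ (covers′ H H⪯F λ (H′ , s′ , p , e) →
          none (H′ , s′ , ⪯-trans H′ H F p H⪯F , ℕₚ.<-≤-trans F<H (⪯⇒len≥ H′ H s p) , e))

        join-killed : ∀ G → ¬ F ⪯ G → Kills Q (join F G)
        join-killed G F⋠G = Q-kills (join F G) (join-isSetComp F G) (join-⪯ˡ F G) (strict-join F G F-comp F⋠G)

        QX-killed : ∀ G → ¬ F ⪯ G → Kills (Q ∘ X) (join F G)
        QX-killed G F⋠G φ C C-word = trans (QX-∘T H φ C C-word) (Σ-0 (setComps n) λ {G′} _ →
          trans (*-congˡ (Q-kills (join H G′) (join-isSetComp H G′)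
            (⪯-trans (join H G′) H F (join-⪯ˡ H G′) (join-⪯ˡ F G))
            (ℕₚ.<-≤-trans (strict-join F G F-comp F⋠G) (⪯⇒len≥ (join H G′) H (join-isSetComp F G) (join-⪯ˡ H G′)))
            φ C C-word)) (zeroʳ _))
          where
          H = join F G

        E-kills : Kills E F
        E-kills φ C C-word = begin
          E (φ ∘T F) C
            ≈⟨ E-expand (φ ∘T F) C C-word ⟩
          Q (X (rev (φ ∘T F))) C + - eig F * q
            ≈⟨ +-congʳ (linear-rev-∘T QX-linear F φ C C-word) ⟩
          combination (setComps n) sgn (λ G → Q (X (φ ∘T join F G))) C + - eig F * q
            ≈⟨ +-congʳ (combination-sgn QX-linear φ C C-word (λ G F⋠G → QX-killed G F⋠G φ C C-word)) ⟩
          sgn F * Q (X (φ ∘T F)) C + - eig F * q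
            ≈⟨ +-congʳ (*-congˡ (QX-∘T F φ C C-word)) ⟩
          sgn F * combination (setComps n) w (λ G → Q (φ ∘T join F G)) C + - eig F * q
            ≈⟨ +-congʳ (*-congˡ (combination-join Q-linear w F F-comp φ C C-word
                 (λ G _ F⋠G → trans (*-congˡ (join-killed G F⋠G φ C C-word)) (zeroʳ _)))) ⟩
          sgn F * (lam F * q) + - eig F * q
            ≈⟨ +-congʳ (sym (*-assoc _ _ _)) ⟩
          eig F * q + - eig F * q
            ≈⟨ distribʳ q _ _ ⟨
          (eig F + - eig F) * q
            ≈⟨ *-congʳ (-‿inverseʳ _) ⟩
          0# * q
            ≈⟨ zeroˡ q ⟩
          0# ∎
          where
          q = Q (φ ∘T F) C

      -- Some strictly finer H₀ has the eigenvalue of F, so lam is constant on the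
      -- set compositions between H₀ and F and Q ∘ X acts on them as a scalar.
      -- As rev ∘ rev is the identity, this forces E (φ ∘T F) to equal its own negative.
      module Recurring (H₀ : SetCompCode n) (H₀-comp : IsSetComp H₀) (H₀⪯F : H₀ ⪯ F) (e₀ : eig H₀ ≈ eig F) where

        λF = lam F

        -- Monotonicity squeezes `lam H` between `lam F` and `lam H′`, which agree.
        lam-between : ∀ H H′ → H ⪯ F → H′ ⪯ H → eig H′ ≈ eig F → lam H ≈ λF
        lam-between H H′ H⪯F H′⪯H e = antisym
          (≤-respʳ-≈ (eig≈⇒lam≈ H′ F e) (lam-mono H′ H H′⪯H)) (lam-mono H F H⪯F)

        QX-scalar-occurs : ∀ H → IsSetComp H → H ⪯ F → (∃ λ H′ → IsSetComp H′ × (H′ ⪯ H × eig H′ ≈ eig F)) →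
                           ∀ φ C → IsWord C → Q (X (φ ∘T H)) C ≈ λF * Q (φ ∘T H) C
        QX-scalar-occurs H s H⪯F (H′ , s′ , H′⪯H , e) φ C C-word = begin
          Q (X (φ ∘T H)) C
            ≈⟨ QX-∘T H φ C C-word ⟩
          combination (setComps n) w (λ G → Q (φ ∘T join H G)) C
            ≈⟨ combination-join Q-linear w H s φ C C-word vanish ⟩
          lam H * Q (φ ∘T H) C
            ≈⟨ *-congʳ lamH ⟩
          λF * Q (φ ∘T H) C ∎
          where
          lamH = lam-between H H′ H⪯F H′⪯H e
          vanish : ∀ G → IsSetComp G → ¬ H ⪯ G → w G * Q (φ ∘T join H G) C ≈ 0#
          vanish G G-comp H⋠G with occurs? F F-comp (join H G)
          -- The value of F still occurs below the join, so `lam` is the same at the join and at H,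
          -- and the weight of G vanishes by `lam-tight`.
          ... | yes (H″ , _ , p , q) = trans (*-congʳ (lam-tight (join H G) H (join-⪯ˡ H G)
                  (trans lamH (sym (lam-between (join H G) H″ (⪯-trans (join H G) H F (join-⪯ˡ H G) H⪯F) p q)))
                  G G-comp (join-⪯ʳ H G) H⋠G)) (zeroˡ _)
          -- The value of F no longer occurs below the join, so the shortened list covers it and `Q`
          -- kills it.
          ... | no none = trans (*-congˡ (ih (join H G) (join-isSetComp H G)
                  (ℕₚ.≤-<-trans (⪯⇒len≥ H F F-comp H⪯F) (strict-join H G s H⋠G)) ks′
                  (covers′ (join H G) (⪯-trans (join H G) H F (join-⪯ˡ H G) H⪯F) none) φ C C-word)) (zeroʳ _)

        QX-scalar : ∀ H → IsSetComp H → H ⪯ F → ∀ φ C → IsWord C → Q (X (φ ∘T H)) C ≈ λF * Q (φ ∘T H) C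
        QX-scalar H s H⪯F φ C C-word with occurs? F F-comp H
        ... | yes o   = QX-scalar-occurs H s H⪯F o φ C C-word
        -- Here both sides are zero: the shortened list covers H and all its refinements.
        ... | no none = trans
          (trans (QX-∘T H φ C C-word) (Σ-0 (setComps n) (λ {G} _ → trans (*-congˡ
            (killed (join H G) (join-isSetComp H G) (join-⪯ˡ H G) φ C C-word)) (zeroʳ _))))
          (sym (trans (*-congˡ (killed H s (⪯-refl H) φ C C-word)) (zeroʳ _)))
          where
          -- F ⪯ H would put H₀ below H.
          F<H : len F ℕ.< len H
          F<H = ⪯∧⋠⇒len< H F H F-comp H⪯F (⪯-refl H) (λ F⪯H → none (H₀ , H₀-comp , ⪯-trans H₀ F H H₀⪯F F⪯H , e₀))
          killed : ∀ H′ → IsSetComp H′ → H′ ⪯ H → Kills Q H′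
          killed H′ s′ p = ih H′ s′ (ℕₚ.<-≤-trans F<H (⪯⇒len≥ H′ H s p)) ks′
            (covers′ H′ (⪯-trans H′ H F p H⪯F) λ (H″ , s″ , p″ , e) → none (H″ , s″ , ⪯-trans H″ H′ H p″ p , e))

        -- `rev` expands into refinements of H, and on all of these `Q ∘ X` is the same scalar; the
        -- expansion can then be folded back.
        QZ-scalar : ∀ H → H ⪯ F → ∀ φ C → IsWord C → Q (Z (φ ∘T H)) C ≈ λF * Q (rev (φ ∘T H)) C
        QZ-scalar H H⪯F φ C C-word = begin
          Q (X (rev (φ ∘T H))) C
            ≈⟨ linear-rev-∘T QX-linear H φ C C-word ⟩
          combination (setComps n) sgn (λ G → Q (X (φ ∘T join H G))) C
            ≈⟨ Σ-cong (setComps n) (λ G → trans (*-congˡ (QX-scalar (join H G) (join-isSetComp H G)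
                 (⪯-trans (join H G) H F (join-⪯ˡ H G) H⪯F) φ C C-word)) (*-swap _ _ _)) ⟩
          Σ[ setComps n ] (λ G → λF * (sgn G * Q (φ ∘T join H G) C))
            ≈⟨ Σ-*ˡ (setComps n) λF _ ⟩
          λF * combination (setComps n) sgn (λ G → Q (φ ∘T join H G)) C
            ≈⟨ *-congˡ (linear-rev-∘T Q-linear H φ C C-word) ⟨
          λF * Q (rev (φ ∘T H)) C ∎

        -- The induction hypothesis is applied with the whole list `ks`. This reaches also those
        -- joins below which the value of F occurs again, where `Q` alone gives no control.
        E-join-killed : ∀ G → ¬ F ⪯ G → Kills E (join F G)
        E-join-killed G F⋠G φ C C-word = trans (sym (P≋E (φ ∘T join F G) C C-word))
          (ih (join F G) (join-isSetComp F G) (strict-join F G F-comp F⋠G) ks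
            (λ H s p → cov H s (⪯-trans H (join F G) F p (join-⪯ˡ F G))) φ C C-word)

        module _ (φ : Fn) (C : List (Fin n)) (C-word : IsWord C) where
          ε q r x : Carrier
          ε = sgn F
          q = Q (φ ∘T F) C
          r = Q (rev (φ ∘T F)) C
          x = E (φ ∘T F) C

          x≈ : x ≈ λF * r + - (ε * λF) * q
          x≈ = trans (E-expand (φ ∘T F) C C-word) (+-congʳ (QZ-scalar F (⪯-refl F) φ C C-word))

          -- Modulo strictly finer terms, which `E` kills, reversal multiplies `φ ∘T F` by its
          -- diagonal entry `sgn F`.
          EA≈εx : E (rev (φ ∘T F)) C ≈ ε * x
          EA≈εx = trans (linear-rev-∘T E-linear F φ C C-word)
            (combination-sgn E-linear φ C C-word (λ G F⋠G → E-join-killed G F⋠G φ C C-word))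

          QZA≈ : Q (Z (rev (φ ∘T F))) C ≈ λF * q
          QZA≈ = begin
            Q (Z (rev (φ ∘T F))) C
              ≈⟨ linear-rev-∘T (∘-linear Q-linear Z-linear) F φ C C-word ⟩
            combination (setComps n) sgn (λ G → Q (Z (φ ∘T join F G))) C
              ≈⟨ Σ-cong (setComps n) (λ G → trans (*-congˡ (QZ-scalar (join F G) (join-⪯ˡ F G) φ C C-word)) (*-swap _ _ _)) ⟩
            Σ[ setComps n ] (λ G → λF * (sgn G * Q (rev (φ ∘T join F G)) C))
              ≈⟨ Σ-*ˡ (setComps n) λF _ ⟩
            λF * combination (setComps n) sgn (λ G → Q (rev (φ ∘T join F G))) C
              ≈⟨ *-congˡ (linear-rev-∘T (∘-linear Q-linear rev-linear) F φ C C-word) ⟨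
            λF * Q (rev (rev (φ ∘T F))) C
              ≈⟨ *-congˡ (cong-≋ Q-linear (λ D _ → reflexive (cong (φ ∘ T F) (Listₚ.reverse-involutive D))) C C-word) ⟩
            λF * q ∎

          EA≈ : E (rev (φ ∘T F)) C ≈ λF * q + - (ε * λF) * r
          EA≈ = trans (E-expand (rev (φ ∘T F)) C C-word) (+-congʳ QZA≈)

          ε[εa]≈a : ∀ a → ε * (ε * a) ≈ a
          ε[εa]≈a a = trans (sym (*-assoc _ _ _)) (trans (*-congʳ (sign-square (n ∸ len F))) (*-identityˡ a))

          -- Reversing the function exchanges `q` and `r` in the formula for `x`. As ε squares to 1,
          -- multiplication by ε then returns the two terms of `x` with opposite signs.
          εEA≈-x : ε * E (rev (φ ∘T F)) C ≈ - x
          εEA≈-x = begin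
            ε * E (rev (φ ∘T F)) C
              ≈⟨ *-congˡ EA≈ ⟩
            ε * (λF * q + - (ε * λF) * r)
              ≈⟨ distribˡ _ _ _ ⟩
            ε * (λF * q) + ε * (- (ε * λF) * r)
              ≈⟨ +-cong (sym (*-assoc _ _ _)) (*-congˡ (sym (-‿distribˡ-* _ _))) ⟩
            (ε * λF) * q + ε * - ((ε * λF) * r)
              ≈⟨ +-congˡ (sym (-‿distribʳ-* _ _)) ⟩
            (ε * λF) * q + - (ε * ((ε * λF) * r))
              ≈⟨ +-congˡ (-‿cong (trans (*-congˡ (*-assoc _ _ _)) (ε[εa]≈a _))) ⟩
            (ε * λF) * q + - (λF * r)
              ≈⟨ +-comm _ _ ⟩
            - (λF * r) + (ε * λF) * q
              ≈⟨ +-congˡ (trans (-‿cong (sym (-‿distribˡ-* _ _))) (-‿involutive _)) ⟨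
            - (λF * r) + - (- (ε * λF) * q)
              ≈⟨ -‿+-comm _ _ ⟩
            - (λF * r + - (ε * λF) * q)
              ≈⟨ -‿cong x≈ ⟨
            - x ∎

          x≈0 : x ≈ 0#
          -- Multiplying `EA≈εx` by ε gives `x` for the quantity that `εEA≈-x` evaluates to its
          -- negative.
          x≈0 = x≈-x⇒x≈0 (trans (sym (ε[εa]≈a x)) (trans (*-congˡ (sym EA≈εx)) εEA≈-x))

      P-kills : Kills (P ks) F
      P-kills φ C C-word with recurs? F F-comp
      ... | yes (H₀ , s , p , _ , e) = trans (P≋E (φ ∘T F) C C-word) (Recurring.x≈0 H₀ s p e φ C C-word)
      ... | no none                  = trans (P≋E (φ ∘T F) C C-word) (NotRecurring.E-kills none φ C C-word)

    -- Induction from many blocks to few, with `d` bounding the number of blocks still missing;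
    -- `len≤n` keeps the truncated difference strictly decreasing.
    annihilation : ∀ d F → IsSetComp F → n ∸ len F ℕ.< d → ∀ ks → Covers ks F → Kills (P ks) F
    annihilation (suc d) F s (ℕ.s≤s F≤d) ks cov = Step.P-kills F s ks cov λ H s′ F<H →
      annihilation d H s′ (ℕₚ.<-≤-trans (ℕₚ.∸-monoʳ-< F<H (len≤n H s′)) F≤d)

-- Descents and cutting words into runs

cut : List ℕ → List A → List (List A)
cut []      l = []
cut (a ∷ α) l = take a l ∷ cut α (drop a l)

cut-concat : (bs : List (List A)) → cut (map length bs) (concat bs) ≡ bs
cut-concat []       = ≡.refl
cut-concat (b ∷ bs) = cong₂ _∷_ (take-length b) (≡.trans (cong (cut (map length bs)) (drop-length b)) (cut-concat bs))
  where
  take-length : ∀ b → take (length b) (b ++ concat bs) ≡ b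
  take-length []      = ≡.refl
  take-length (x ∷ b) = cong (x ∷_) (take-length b)
  drop-length : ∀ b → drop (length b) (b ++ concat bs) ≡ concat bs
  drop-length []      = ≡.refl
  drop-length (x ∷ b) = drop-length b

length-drop-+ : ∀ a {s} (l : List A) → length l ≡ a ℕ.+ s → length (drop a l) ≡ s
length-drop-+ a l e = ≡.trans (Listₚ.length-drop a l) (≡.trans (cong (_∸ a) e) (ℕₚ.m+n∸m≡n a _))

concat-cut : ∀ α (l : List A) → length l ≡ sum α → concat (cut α l) ≡ l
concat-cut []      []      e = ≡.refl
concat-cut (a ∷ α) l       e = ≡.trans
  (cong (take a l ++_) (concat-cut α (drop a l) (length-drop-+ a l e))) (Listₚ.take++drop≡id a l)

length-cut : ∀ α (l : List A) → length l ≡ sum α → map length (cut α l) ≡ α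
length-cut []      l e = ≡.refl
length-cut (a ∷ α) l e = cong₂ _∷_
  (≡.trans (Listₚ.length-take a l) (ℕₚ.m≤n⇒m⊓n≡m (subst (a ℕ.≤_) (≡.sym e) (ℕₚ.m≤m+n a _))))
  (length-cut α (drop a l) (length-drop-+ a l e))

cut-map : ∀ α (f : A → B) (l : List A) → cut α (map f l) ≡ map (map f) (cut α l)
cut-map []      f l = ≡.refl
cut-map (a ∷ α) f l = cong₂ _∷_ (Listₚ.take-map a l) (≡.trans (cong (cut α) (Listₚ.drop-map a l)) (cut-map α f (drop a l)))

desFrom-suc : ∀ k x l → desFrom (suc k) (x ∷ l) ≡ map suc (desFrom k (x ∷ l))
desFrom-suc k x []      = ≡.refl
desFrom-suc k x (y ∷ l) with y <ᵇ x
... | true  = cong (suc k ∷_) (desFrom-suc (suc k) y l)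
... | false = desFrom-suc (suc k) y l

all-map : (b : B → Bool) (f : A → B) (xs : List A) → all b (map f xs) ≡ all (b ∘ f) xs
all-map b f []       = ≡.refl
all-map b f (x ∷ xs) = cong (b (f x) ∧_) (all-map b f xs)

all-cong : {b b′ : A → Bool} → (∀ x → b x ≡ b′ x) → ∀ xs → all b xs ≡ all b′ xs
all-cong e []       = ≡.refl
all-cong e (x ∷ xs) = cong₂ _∧_ (e x) (all-cong e xs)

memB-suc : ∀ i xs → memB (suc i) (map suc xs) ≡ memB i xs
memB-suc i []       = ≡.refl
memB-suc i (x ∷ xs) = cong ((i ≡ᵇ x) ∨_) (memB-suc i xs)

descentsIn : List ℕ → List ℕ → Bool
descentsIn l α = all (λ i → memB i (D α)) (desFrom 1 l)

D-suc : ∀ a α → D (suc a ∷ α) ≡ map suc (D (a ∷ α))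
D-suc a []      = ≡.refl
D-suc a (b ∷ α) = cong (suc a ∷_) (Listₚ.map-∘ (D (b ∷ α)))

memB-0-D : ∀ a α → memB 0 (D (suc a ∷ α)) ≡ false
memB-0-D a α = ≡.trans (cong (memB 0) (D-suc a α)) (go (D (a ∷ α)))
  where
  go : ∀ xs → memB 0 (map suc xs) ≡ false
  go []       = ≡.refl
  go (x ∷ xs) = go xs

-- A first part 1 permits a descent at position 1, and dropping the first letter shifts all later
-- positions by one.
descentsIn-1∷ : ∀ x y l b α → descentsIn (x ∷ y ∷ l) (1 ∷ b ∷ α) ≡ descentsIn (y ∷ l) (b ∷ α)
descentsIn-1∷ x y l b α = ≡.trans first (≡.trans (cong (all inD) shift) (≡.trans (all-map inD (λ i → ℕ.suc (ℕ.suc i)) ds) (≡.trans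
  (all-cong (λ i → memB-suc (suc i) (D (b ∷ α))) ds)
  (≡.sym (≡.trans (cong (all inD′) (desFrom-suc 0 y l)) (all-map inD′ suc ds))))))
  where
  inD inD′ : ℕ → Bool
  inD i = memB i (D (1 ∷ b ∷ α))
  inD′ i = memB i (D (b ∷ α))
  -- Counting from 0 makes both descent lists shifts of the same list, by two and by one.
  ds = desFrom 0 (y ∷ l)
  first : descentsIn (x ∷ y ∷ l) (1 ∷ b ∷ α) ≡ all inD (desFrom 2 (y ∷ l))
  first with y <ᵇ x
  ... | true  = ≡.refl
  ... | false = ≡.refl
  shift : desFrom 2 (y ∷ l) ≡ map (λ i → ℕ.suc (ℕ.suc i)) ds
  shift = ≡.trans (desFrom-suc 1 y l) (≡.trans (cong (map suc) (desFrom-suc 0 y l)) (≡.sym (Listₚ.map-∘ ds)))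

-- A first part of at least 2 keeps position 1 out of `D`, so a descent there is fatal; otherwise
-- the part shrinks by one.
descentsIn-suc∷ : ∀ x y l a α → descentsIn (x ∷ y ∷ l) (suc (suc a) ∷ α) ≡
                  (if y <ᵇ x then false else descentsIn (y ∷ l) (suc a ∷ α))
descentsIn-suc∷ x y l a α with y <ᵇ x
... | true  rewrite D-suc (suc a) α | memB-suc 0 (D (suc a ∷ α)) | memB-0-D a α = ≡.refl
... | false rewrite desFrom-suc 1 y l | D-suc (suc a) α =
  ≡.trans (all-map (λ i → memB i (map suc (D (suc a ∷ α)))) suc (desFrom 1 (y ∷ l))) (all-cong (λ i → memB-suc i (D (suc a ∷ α))) (desFrom 1 (y ∷ l)))

Positive : List ℕ → Set
Positive = All (λ a → ∃ λ b → a ≡ suc b)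

-- A descent at a position outside D(α) is precisely a descent inside one of the pieces into which α
-- cuts the word.
descentsIn-reflects∷ : ∀ α x l → Positive α → length (x ∷ l) ≡ sum α →
                       Reflects (All (Linked ℕ._≤_) (cut α (x ∷ l))) (descentsIn (x ∷ l) α)
descentsIn-reflects∷ (.(suc zero) ∷ []) x [] ((zero , ≡.refl) ∷ pos) e = ofʸ ([-] ∷ [])
descentsIn-reflects∷ (.(suc zero) ∷ []) x (y ∷ l) ((zero , ≡.refl) ∷ pos) ()
descentsIn-reflects∷ (.(suc zero) ∷ _ ∷ α) x [] ((zero , ≡.refl) ∷ (b , ≡.refl) ∷ pos) ()
descentsIn-reflects∷ (.(suc zero) ∷ b ∷ α) x (y ∷ l) ((zero , ≡.refl) ∷ pos) e
  rewrite descentsIn-1∷ x y l b α =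
  reflects-map ([-] ∷_) All.tail (descentsIn-reflects∷ (b ∷ α) y l pos (ℕₚ.suc-injective e))
descentsIn-reflects∷ (.(suc (suc a)) ∷ α) x [] ((suc a , ≡.refl) ∷ pos) ()
descentsIn-reflects∷ (.(suc (suc a)) ∷ α) x (y ∷ l) ((suc a , ≡.refl) ∷ pos) e
  rewrite descentsIn-suc∷ x y l a α with y <ᵇ x | ℕₚ.<ᵇ-reflects-< y x
... | true  | ofʸ y<x = ofⁿ λ { ((x≤y ∷ _) ∷ _) → ℕₚ.<⇒≱ y<x x≤y }
... | false | ofⁿ y≮x = reflects-map
  (λ { (lk ∷ lks) → (ℕₚ.≮⇒≥ y≮x ∷ lk) ∷ lks })
  (λ { ((_ ∷ lk) ∷ lks) → lk ∷ lks })
  (descentsIn-reflects∷ (suc a ∷ α) y l ((a , ≡.refl) ∷ pos) (ℕₚ.suc-injective e))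

descentsIn-reflects : ∀ α l → Positive α → length l ≡ sum α →
                      Reflects (All (Linked ℕ._≤_) (cut α l)) (descentsIn l α)
descentsIn-reflects []      []      pos                  e = ofʸ []
descentsIn-reflects (_ ∷ α) []      ((b , ≡.refl) ∷ pos) ()
descentsIn-reflects α       (x ∷ l) pos                  e = descentsIn-reflects∷ α x l pos e

compositions-sound : ∀ n {α} → α ∈≡ compositions n → Positive α × sum α ≡ n
compositions-sound zero    (here ≡.refl) = [] , ≡.refl
compositions-sound (suc n) α∈ with find (∈-concatMap⁻ _ {xs = compositions n} α∈)
... | [] , β∈ , here ≡.refl = (0 , ≡.refl) ∷ [] , cong suc (proj₂ (compositions-sound n β∈))
... | b ∷ β , β∈ , here ≡.refl = (0 , ≡.refl) ∷ proj₁ (compositions-sound n β∈) , cong suc (proj₂ (compositions-sound n β∈))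
... | b ∷ β , β∈ , there (here ≡.refl) = (b , ≡.refl) ∷ All.tail (proj₁ (compositions-sound n β∈)) , cong suc (proj₂ (compositions-sound n β∈))

-- Set compositions as lists of increasing blocks

Increasing : List (Fin n) → Set
Increasing = Linked Fin._≤_

desSubB-reflects : (v : Perm n) → ∀ {α} → α ∈≡ compositions n → Reflects (All Increasing (cut α (toList v))) (desSubB v α)
desSubB-reflects {n} v {α} α∈ = reflects-map to from
  (descentsIn-reflects α (map toℕ (toList v)) (proj₁ (compositions-sound n α∈))
    (≡.trans (Listₚ.length-map toℕ (toList v)) (≡.trans (Vecₚ.length-toList v) (≡.sym (proj₂ (compositions-sound n α∈))))))
  where
  to : All (Linked ℕ._≤_) (cut α (map toℕ (toList v))) → All Increasing (cut α (toList v))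
  to ps = All.map Linkedₚ.map⁻ (Allₚ.map⁻ (subst (All (Linked ℕ._≤_)) (cut-map α toℕ (toList v)) ps))
  from : All Increasing (cut α (toList v)) → All (Linked ℕ._≤_) (cut α (map toℕ (toList v)))
  from ps = subst (All (Linked ℕ._≤_)) (≡.sym (cut-map α toℕ (toList v))) (Allₚ.map⁺ (All.map Linkedₚ.map⁺ ps))

blocks : SetCompCode n → List (List (Fin n))
blocks {n} (m , f) = List.tabulate {n = m} (λ j → filter (λ i → lookup f i ≟ᶠ j) (allFin n))

concat-tabulate : ∀ m (h : Fin m → List A) → concat (List.tabulate h) ≡ cat m h
concat-tabulate zero    h = ≡.refl
concat-tabulate (suc m) h = cong (h zero ++_) (concat-tabulate m (h ∘ suc))

concat-blocks : (G : SetCompCode n) → concat (blocks G) ≡ T G (allFin n)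
concat-blocks (m , g) = concat-tabulate m _

length-blocks : (G : SetCompCode n) → map length (blocks G) ≡ typeOf G
length-blocks (m , g) = ≡.trans (Listₚ.map-tabulate {n = m} _ length) (≡.sym (Listₚ.map-tabulate {n = m} id _))

-- Hence G can be recovered from its type and the word it produces from the identity.
cut-T : (G : SetCompCode n) → cut (typeOf G) (T G (allFin n)) ≡ blocks G
cut-T G = ≡.trans (cong₂ cut (≡.sym (length-blocks G)) (≡.sym (concat-blocks G))) (cut-concat (blocks G))

allFin-increasing : ∀ n → Increasing (allFin n)
allFin-increasing n = Linkedₚ.AllPairs⇒Linked (AllPairsₚ.tabulate⁺-< ℕₚ.<⇒≤)

blocks-increasing : (G : SetCompCode n) → All Increasing (blocks G)
blocks-increasing {n} (m , g) = Allₚ.tabulate⁺ {n = m} (λ j → Linkedₚ.filter⁺ (λ i → lookup g i ≟ᶠ j) Finₚ.≤-trans (allFin-increasing n))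

tabulate-injective : {h h′ : Fin m → A} → List.tabulate h ≡ List.tabulate h′ → ∀ j → h j ≡ h′ j
tabulate-injective e zero    = Listₚ.∷-injectiveˡ e
tabulate-injective e (suc j) = tabulate-injective (Listₚ.∷-injectiveʳ e) j

blocks-injective : {F G : SetCompCode n} → blocks F ≡ blocks G → F ≡ G
blocks-injective {n} {m , f} {k , g} e with ≡.trans (≡.sym (Listₚ.length-tabulate {n = m} _)) (≡.trans (cong length e) (Listₚ.length-tabulate {n = k} _))
... | ≡.refl = cong (m ,_) (≡.trans (≡.sym (Vecₚ.tabulate∘lookup f)) (≡.trans (Vecₚ.tabulate-cong pointwise) (Vecₚ.tabulate∘lookup g)))
  where
  pointwise : ∀ i → lookup f i ≡ lookup g i
  pointwise i = ≡.sym (proj₂ (∈-filter⁻ (λ l → lookup g l ≟ᶠ lookup f i) {xs = allFin n}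
    (subst (i ∈≡_) (tabulate-injective {m = m} e (lookup f i)) (∈-filter⁺ (λ l → lookup f l ≟ᶠ lookup f i) (∈-allFin i) ≡.refl))))

unique-++⇒disjoint : (xs {ys} : List A) → Unique≡ (xs ++ ys) → ∀ {x} → x ∈≡ xs → ¬ x ∈≡ ys
unique-++⇒disjoint (x ∷ xs) (x∉ ∷ u) (here ≡.refl) q = All.lookup x∉ (∈-++⁺ʳ xs q) ≡.refl
unique-++⇒disjoint (x ∷ xs) (x∉ ∷ u) (there p)   q = unique-++⇒disjoint xs u p q

unique-++⇒ʳ : (xs {ys} : List A) → Unique≡ (xs ++ ys) → Unique≡ ys
unique-++⇒ʳ []       u       = u
unique-++⇒ʳ (x ∷ xs) (_ ∷ u) = unique-++⇒ʳ xs u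

unique-++⇒ˡ : (xs {ys} : List A) → Unique≡ (xs ++ ys) → Unique≡ xs
unique-++⇒ˡ []       u        = []
unique-++⇒ˡ (x ∷ xs) (x∉ ∷ u) = Allₚ.++⁻ˡ xs x∉ ∷ unique-++⇒ˡ xs u

unique-block : (bs : List (List A)) → Unique≡ (concat bs) → ∀ j → Unique≡ (List.lookup bs j)
unique-block (b ∷ bs) u zero    = unique-++⇒ˡ b u
unique-block (b ∷ bs) u (suc j) = unique-block bs (unique-++⇒ʳ b u) j

∈-block⇒∈-concat : (bs : List (List A)) → ∀ j {x} → x ∈≡ List.lookup bs j → x ∈≡ concat bs
∈-block⇒∈-concat (b ∷ bs) zero    p = ∈-++⁺ˡ p
∈-block⇒∈-concat (b ∷ bs) (suc j) p = ∈-++⁺ʳ b (∈-block⇒∈-concat bs j p)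

block-index-unique : (bs : List (List A)) → Unique≡ (concat bs) → ∀ j k {x} →
                     x ∈≡ List.lookup bs j → x ∈≡ List.lookup bs k → j ≡ k
block-index-unique (b ∷ bs) u zero    zero    p q = ≡.refl
block-index-unique (b ∷ bs) u zero    (suc k) p q = contradiction (∈-block⇒∈-concat bs k q) (unique-++⇒disjoint b u p)
block-index-unique (b ∷ bs) u (suc j) zero    p q = contradiction (∈-block⇒∈-concat bs j p) (unique-++⇒disjoint b u q)
block-index-unique (b ∷ bs) u (suc j) (suc k) p q = cong suc (block-index-unique bs (unique-++⇒ʳ b u) j k p q)

-- In a word every letter occurs once, so it lies in exactly one of the lists, and the index of that
-- list is its label. Positive lengths make the labelling surjective.
setComp-of-blocks : (bs : List (List (Fin n))) → IsWord (concat bs) → All Increasing bs → Positive (map length bs) →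
                    ∃ λ G → IsSetComp G × blocks G ≡ bs
setComp-of-blocks {n} bs C-word inc pos = (N , tabulate g) , surj , ≡.trans
  (Listₚ.tabulate-cong {n = N} block≡) (Listₚ.tabulate-lookup bs)
  where
  N : ℕ
  N = length bs
  C-unique = word-unique C-word

  found : ∀ i → Any (i ∈≡_) bs
  found i = ∈-concat⁻ bs (Permₚ.∈-resp-↭ (↭-sym C-word) (∈-allFin i))

  g : Fin n → Fin N
  g i = Any.index (found i)

  i∈ : ∀ i → i ∈≡ List.lookup bs (g i)
  i∈ i = Anyₚ.lookup-index (found i)

  gcode : ∀ i → lookup (tabulate g) i ≡ g i
  gcode = Vecₚ.lookup∘tabulate g

  g-block : ∀ i j → i ∈≡ List.lookup bs j → g i ≡ j
  g-block i j p = block-index-unique bs C-unique (g i) j (i∈ i) p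

  block≡ : ∀ j → filter (λ i → lookup (tabulate g) i ≟ᶠ j) (allFin n) ≡ List.lookup bs j
  -- Both lists are repetition-free with the same members, hence permutations of each other, and
  -- sorted lists with this property coincide.
  block≡ j = ≋⇒≡ (↗↭↗⇒≋ (Finₚ.≤-totalOrder n)
    (Linkedₚ.filter⁺ (λ i → lookup (tabulate g) i ≟ᶠ j) Finₚ.≤-trans (allFin-increasing n))
    (All.lookup inc (∈-lookup j))
    (Perm.↭⇒↭ₛ (∼bag⇒↭ (unique∧set⇒bag (Uniqueₚ.filter⁺ _ (Uniqueₚ.allFin⁺ n)) (unique-block bs C-unique j) (mk⇔ to from)))))
    where
    to : ∀ {i} → i ∈≡ filter (λ i → lookup (tabulate g) i ≟ᶠ j) (allFin n) → i ∈≡ List.lookup bs j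
    to {i} p = subst (λ k → i ∈≡ List.lookup bs k)
      (≡.trans (≡.sym (gcode i)) (proj₂ (∈-filter⁻ (λ i → lookup (tabulate g) i ≟ᶠ j) {xs = allFin n} p))) (i∈ i)
    from : ∀ {i} → i ∈≡ List.lookup bs j → i ∈≡ filter (λ i → lookup (tabulate g) i ≟ᶠ j) (allFin n)
    from {i} p = ∈-filter⁺ _ (∈-allFin i) (≡.trans (gcode i) (g-block i j p))

  surj : IsSetComp (N , tabulate g)
  surj j with List.lookup bs j in e | All.lookup pos (∈-map⁺ length (∈-lookup {xs = bs} j))
  ... | []    | b , p = contradiction p λ ()
  ... | i ∷ _ | _ = i , ≡.trans (gcode i) (g-block i j (subst (i ∈≡_) (≡.sym e) (here ≡.refl)))

-- Permutations read as words

perm⇒word : (t : Perm n) → IsInjective t → {C : List (Fin n)} → IsWord C → IsWord (map (lookup t) C)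
perm⇒word {n} t inj C-word = ↭-trans (Permₚ.map⁺ (lookup t) C-word)
  (map-bijection-↭ (Uniqueₚ.allFin⁺ n) (Uniqueₚ.allFin⁺ n) (lookup t) (λ _ → ∈-allFin _) (λ _ _ → inj _ _)
    (λ {y} _ → let (x , e) = injective⇒surjective t inj y in x , ∈-allFin x , ≡.sym e))

compose-injective : {s t : Perm n} → IsInjective s → IsInjective t → IsInjective (compose s t)
compose-injective {s = s} {t} s-inj t-inj i j e = t-inj i j (s-inj _ _
  (≡.trans (≡.sym (Vecₚ.lookup∘tabulate (λ i → lookup s (lookup t i)) i)) (≡.trans e (Vecₚ.lookup∘tabulate (λ i → lookup s (lookup t i)) j))))

toList-tabulate : {A : Set} (f : Fin k → A) → toList (tabulate f) ≡ List.tabulate f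
toList-tabulate {k = zero}  f = ≡.refl
toList-tabulate {k = suc k} f = cong (f zero ∷_) (toList-tabulate (f ∘ suc))

toList-compose : (s t : Perm n) → toList (compose s t) ≡ map (lookup s) (toList t)
toList-compose {n} s t = ≡.trans (toList-tabulate _) (≡.trans (≡.sym (Listₚ.map-tabulate (lookup t) (lookup s)))
  (cong (map (lookup s)) (≡.trans (≡.sym (Listₚ.map-tabulate id (lookup t))) (≡.sym (toList-lookup t)))))

toList-injective : {A : Set} {u v : Vec A k} → toList u ≡ toList v → u ≡ v
toList-injective {u = []}    {[]}    e = ≡.refl
toList-injective {u = x ∷ u} {y ∷ v} e = cong₂ _∷_ (Listₚ.∷-injectiveˡ e) (toList-injective (Listₚ.∷-injectiveʳ e))

toList-w₀ : ∀ n → toList (w₀ n) ≡ reverse (allFin n)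
toList-w₀ n = ≡.trans (toList-tabulate opposite) (go n)
  where
  snoc : ∀ {A : Set} n (f : Fin (suc n) → A) → List.tabulate f ≡ List.tabulate (f ∘ inject₁) ++ f (Fin.fromℕ n) ∷ []
  snoc zero    f = ≡.refl
  snoc (suc n) f = cong (f zero ∷_) (snoc n (f ∘ suc))
  go : ∀ n → List.tabulate {n = n} opposite ≡ reverse (allFin n)
  go zero    = ≡.refl
  go (suc n) = ≡.sym (≡.trans (cong reverse (snoc n id)) (≡.trans
    (Listₚ.reverse-++ (List.tabulate inject₁) (Fin.fromℕ n ∷ []))
    (cong (Fin.fromℕ n ∷_) (≡.trans (cong reverse (≡.sym (Listₚ.map-tabulate id inject₁)))
      (≡.trans (≡.sym (Listₚ.reverse-map inject₁ (allFin n)))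
        (≡.trans (cong (map inject₁) (≡.sym (go n))) (Listₚ.map-tabulate opposite inject₁)))))))

w₀-injective : ∀ n → IsInjective (w₀ n)
w₀-injective n i j e = ≡.trans (≡.sym (Finₚ.opposite-involutive i)) (≡.trans (cong opposite e′) (Finₚ.opposite-involutive j))
  where
  e′ : opposite i ≡ opposite j
  e′ = ≡.trans (≡.sym (Vecₚ.lookup∘tabulate opposite i)) (≡.trans e (Vecₚ.lookup∘tabulate opposite j))

id-injective : ∀ n → IsInjective (tabulate {n = n} id)
id-injective n i j e = ≡.trans (≡.sym (Vecₚ.lookup∘tabulate id i)) (≡.trans e (Vecₚ.lookup∘tabulate id j))

typeOf-relabel : (t : Perm n) → IsInjective t → ∀ G → typeOf (relabel t G) ≡ typeOf G
typeOf-relabel {n} t inj (m , g) = Listₚ.map-cong block-size (allFin m)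
  where
  filter-map : ∀ j C → map (lookup t) (filter (λ i → lookup g (lookup t i) ≟ᶠ j) C) ≡ filter (λ i → lookup g i ≟ᶠ j) (map (lookup t) C)
  filter-map j []      = ≡.refl
  filter-map j (x ∷ C) with lookup g (lookup t x) ≟ᶠ j
  ... | yes _ = cong (lookup t x ∷_) (filter-map j C)
  ... | no  _ = filter-map j C
  block-size : ∀ j → length (filter (λ i → lookup (tabulate (λ i → lookup g (lookup t i))) i ≟ᶠ j) (allFin n)) ≡
                     length (filter (λ i → lookup g i ≟ᶠ j) (allFin n))
  block-size j = ≡.trans
    (cong length (filter-≐ (λ i → lookup (tabulate (λ i → lookup g (lookup t i))) i ≟ᶠ j) (λ i → lookup g (lookup t i) ≟ᶠ j)
      ((λ {i} e → ≡.trans (≡.sym (Vecₚ.lookup∘tabulate (λ i → lookup g (lookup t i)) i)) e)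
      , (λ {i} e → ≡.trans (Vecₚ.lookup∘tabulate (λ i → lookup g (lookup t i)) i) e)) (allFin n)))
    (≡.trans (≡.sym (Listₚ.length-map (lookup t) (filter (λ i → lookup g (lookup t i) ≟ᶠ j) (allFin n)))) (≡.trans (cong length (filter-map j (allFin n)))
      (Permₚ.↭-length (Permₚ.filter-↭ (λ i → lookup g i ≟ᶠ j) (perm⇒word t inj ↭-refl)))))

-- The group algebra paired with functions on words

typeIs : List ℕ → SetCompCode n → Bool
typeIs α G = ⌊ Listₚ.≡-dec ℕ._≟_ (typeOf G) α ⌋

module Pairing {c ℓ} (R : CommutativeRing c ℓ) where
  open CommutativeRing R hiding (zero)
  open InRing R
  open Sums R
  open SetoidReasoning setoid

  -- Sorting the identity word is a bijection from the set compositions of type α to the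
  -- permutations with descents in D(α); its inverse cuts a permutation into increasing runs of
  -- lengths α. This is how B_α turns into a sum of operators T_G.
  Σ-descents : ∀ {α} → α ∈≡ compositions n → (ψ : List (Fin n) → Carrier) →
               Σ[ perms n ] (λ v → if desSubB v α then ψ (toList v) else 0#) ≈
               Σ[ setComps n ] (λ G → if typeIs α G then ψ (T G (allFin n)) else 0#)
  Σ-descents {n} {α} α∈ ψ = begin
    Σ[ perms n ] (λ v → if desSubB v α then ψ (toList v) else 0#)
      ≈⟨ Σ-filter (λ v → desSubB v α) (perms n) (ψ ∘ toList) ⟨
    Σ[ vs ] (ψ ∘ toList)
      ≈⟨ Σ-map vs toList ψ ⟨
    Σ[ map toList vs ] ψ
      ≈⟨ Σ-bijection ψ (Uniqueₚ.filter⁺ _ (setComps-unique n)) (Uniqueₚ.map⁺ toList-injective (Uniqueₚ.filter⁺ _ (perms-unique n)))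
           (λ G → T G (allFin n)) into injective onto ⟨
    Σ[ Gs ] (λ G → ψ (T G (allFin n)))
      ≈⟨ Σ-filter (typeIs α) (setComps n) _ ⟩
    Σ[ setComps n ] (λ G → if typeIs α G then ψ (T G (allFin n)) else 0#) ∎
    where
    vs : List (Perm n)
    vs = filter (λ v → desSubB v α ≟B true) (perms n)
    Gs : List (SetCompCode n)
    Gs = filter (λ G → typeIs α G ≟B true) (setComps n)

    Gs⁻ : ∀ {G} → G ∈≡ Gs → IsSetComp G × typeOf G ≡ α
    Gs⁻ {G} G∈ = let (p , q) = ∈-filter⁻ (λ G → typeIs α G ≟B true) {xs = setComps n} G∈
                 in ∈-setComps⁻ p , true-reflects (isYes-reflects (Listₚ.≡-dec ℕ._≟_ (typeOf G) α)) q

    into : ∀ {G} → G ∈≡ Gs → T G (allFin n) ∈≡ map toList vs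
    into {G} G∈ with Gs⁻ G∈ | word⇒perm (word-T G ↭-refl)
    ... | _ , e | t , t-inj , te = subst (_∈≡ map toList vs) te (∈-map⁺ toList (∈-filter⁺ _ (∈-perms⁺ t-inj)
      (reflects-true (desSubB-reflects t α∈)
        (subst (All Increasing) (≡.sym (≡.trans (cong₂ cut (≡.sym e) te) (cut-T G))) (blocks-increasing G)))))

    injective : ∀ {F G} → F ∈≡ Gs → G ∈≡ Gs → T F (allFin n) ≡ T G (allFin n) → F ≡ G
    injective {F} {G} F∈ G∈ e = blocks-injective (≡.trans (≡.sym (cut-T F))
      (≡.trans (cong₂ cut (≡.trans (proj₂ (Gs⁻ F∈)) (≡.sym (proj₂ (Gs⁻ G∈)))) e) (cut-T G)))

    onto : ∀ {C} → C ∈≡ map toList vs → ∃ λ G → G ∈≡ Gs × C ≡ T G (allFin n)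
    onto C∈ with ∈-map⁻ toList C∈
    ... | v , v∈ , ≡.refl with ∈-filter⁻ (λ v → desSubB v α ≟B true) {xs = perms n} v∈ | compositions-sound n α∈
    ...   | v∈′ , des | pos , total = G , G∈ , ≡.trans (≡.sym concat≡) (≡.trans (cong List.concat (≡.sym G-blocks)) (concat-blocks G))
      where
      size = ≡.trans (Vecₚ.length-toList v) (≡.sym total)
      concat≡ = concat-cut α (toList v) size
      lengths = length-cut α (toList v) size
      v-word : IsWord (toList v)
      v-word = subst IsWord (≡.sym (toList-lookup v)) (perm⇒word v (∈-perms⁻ v∈′) ↭-refl)
      found = setComp-of-blocks (cut α (toList v)) (subst IsWord (≡.sym concat≡) v-word)
        (true-reflects (desSubB-reflects v α∈) des) (subst Positive (≡.sym lengths) pos)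
      G = proj₁ found
      G-blocks = proj₂ (proj₂ found)
      G∈ : G ∈≡ Gs
      G∈ = ∈-filter⁺ _ (∈-setComps⁺ (proj₁ (proj₂ found)))
        (reflects-true (isYes-reflects (Listₚ.≡-dec ℕ._≟_ (typeOf G) α))
          (≡.trans (≡.sym (length-blocks G)) (≡.trans (cong (map length) G-blocks) lengths)))

  Σ-indicator : {A : Set} (_≟_ : DecidableEquality A) {xs : List A} → Unique≡ xs → ∀ {v} → v ∈≡ xs → (h : A → Carrier) →
                Σ[ xs ] (λ t → if ⌊ v ≟ t ⌋ then h t else 0#) ≈ h v
  Σ-indicator _≟_ {x ∷ xs} (x∉ ∷ u) {v} (here ≡.refl) h = trans (+-cong
    (reflexive (cong (λ b → if b then h v else 0#) (reflects-true (isYes-reflects (v ≟ v)) ≡.refl)))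
    (Σ-0 xs (λ {t} t∈ → reflexive (cong (λ b → if b then h t else 0#) (reflects-false (isYes-reflects (v ≟ t)) (All.lookup x∉ t∈))))))
    (+-identityʳ _)
  Σ-indicator _≟_ {x ∷ xs} (x∉ ∷ u) {v} (there v∈) h = trans (+-cong
    (reflexive (cong (λ b → if b then h x else 0#) (reflects-false (isYes-reflects (v ≟ x)) (All.lookup x∉ v∈ ∘ ≡.sym))))
    (Σ-indicator _≟_ u v∈ h)) (+-identityˡ _)

  if-* : ∀ b x y → (if b then x else 0#) * y ≈ (if b then x * y else 0#)
  if-* true  x y = refl
  if-* false x y = zeroˡ y

  *-if : ∀ b x y → x * (if b then y else 0#) ≈ (if b then x * y else 0#)
  *-if true  x y = refl
  *-if false x y = zeroʳ x

  if-cong : ∀ b {x y} → x ≈ y → (if b then x else 0#) ≈ (if b then y else 0#)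
  if-cong true  e = e
  if-cong false e = refl

  Fn : ℕ → Set c
  Fn n = List (Fin n) → Carrier

  ⟨_,_⟩ : KS n → Fn n → Carrier
  ⟨_,_⟩ {n} a ψ = Σ[ perms n ] (λ t → a t * ψ (toList t))

  translate : Perm n → Fn n → Fn n
  translate t ψ C = ψ (map (lookup t) C)

  ⟨δ⟩ : (v : Perm n) → IsInjective v → ∀ ψ → ⟨ δ v , ψ ⟩ ≈ ψ (toList v)
  ⟨δ⟩ {n} v inj ψ = trans (Σ-cong (perms n) (λ t → trans (if-* _ 1# _) (if-cong _ (*-identityˡ _))))
    (Σ-indicator (Vecₚ.≡-dec _≟ᶠ_) (perms-unique n) (∈-perms⁺ inj) (ψ ∘ toList))

  -- The left factor permutes the letters of the word given by the right one, so it can be absorbed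
  -- into the test function and products are evaluated one factor at a time.
  ⟨⊗⟩ : (a b : KS n) (ψ : Fn n) → ⟨ a ⊗ b , ψ ⟩ ≈ Σ[ perms n ] (λ s → a s * ⟨ b , translate s ψ ⟩)
  ⟨⊗⟩ {n} a b ψ = begin
    Σ[ perms n ] (λ u → Σ[ perms n ] (λ s → Σ[ perms n ] (λ t → term s t u)) * ψ (toList u))
      ≈⟨ Σ-cong (perms n) (λ u → trans (sym (Σ-*ʳ (perms n) _ _)) (Σ-cong (perms n) (λ s → sym (Σ-*ʳ (perms n) _ _)))) ⟩
    Σ[ perms n ] (λ u → Σ[ perms n ] (λ s → Σ[ perms n ] (λ t → term s t u * ψ (toList u))))
      ≈⟨ Σ-swap (perms n) (perms n) _ ⟩
    Σ[ perms n ] (λ s → Σ[ perms n ] (λ u → Σ[ perms n ] (λ t → term s t u * ψ (toList u))))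
      ≈⟨ Σ-cong (perms n) (λ s → Σ-swap (perms n) (perms n) _) ⟩
    Σ[ perms n ] (λ s → Σ[ perms n ] (λ t → Σ[ perms n ] (λ u → term s t u * ψ (toList u))))
      ≈⟨ Σ-cong-∈ (perms n) (λ {s} s∈ → Σ-cong-∈ (perms n) (λ {t} t∈ → collapse s t s∈ t∈)) ⟩
    Σ[ perms n ] (λ s → Σ[ perms n ] (λ t → a s * (b t * translate s ψ (toList t))))
      ≈⟨ Σ-cong (perms n) (λ s → Σ-*ˡ (perms n) (a s) _) ⟩
    Σ[ perms n ] (λ s → a s * ⟨ b , translate s ψ ⟩) ∎
    where
    term : Perm n → Perm n → Perm n → Carrier
    term s t u = if ⌊ Vecₚ.≡-dec _≟ᶠ_ (compose s t) u ⌋ then a s * b t else 0#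
    collapse : ∀ s t → s ∈≡ perms n → t ∈≡ perms n →
               Σ[ perms n ] (λ u → term s t u * ψ (toList u)) ≈ a s * (b t * translate s ψ (toList t))
    collapse s t s∈ t∈ = begin
      Σ[ perms n ] (λ u → term s t u * ψ (toList u))
        ≈⟨ Σ-cong (perms n) (λ u → if-* _ _ _) ⟩
      Σ[ perms n ] (λ u → if ⌊ Vecₚ.≡-dec _≟ᶠ_ (compose s t) u ⌋ then (a s * b t) * ψ (toList u) else 0#)
        ≈⟨ Σ-indicator (Vecₚ.≡-dec _≟ᶠ_) (perms-unique n) {compose s t} (∈-perms⁺ (compose-injective {s = s} {t} (∈-perms⁻ s∈) (∈-perms⁻ t∈)))
             (λ u → (a s * b t) * ψ (toList u)) ⟩
      (a s * b t) * ψ (toList (compose s t))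
        ≈⟨ trans (*-assoc _ _ _) (*-congˡ (*-congˡ (reflexive (cong ψ (toList-compose s t))))) ⟩
      a s * (b t * translate s ψ (toList t)) ∎

  indicator : Perm n → Fn n
  indicator v C = if ⌊ Listₚ.≡-dec _≟ᶠ_ C (toList v) ⌋ then 1# else 0#

  -- Valid even off S_n, where both sides vanish.
  ⊗-coefficient : (a b : KS n) (v : Perm n) → (a ⊗ b) v ≈ ⟨ a ⊗ b , indicator v ⟩
  ⊗-coefficient {n} a b v = trans
    (Σ-cong (perms n) (λ s → trans (Σ-cong (perms n) (term s)) (Σ-*ˡ (perms n) (a s) _)))
    (sym (⟨⊗⟩ a b (indicator v)))
    where
    term : ∀ s t → (if ⌊ Vecₚ.≡-dec _≟ᶠ_ (compose s t) v ⌋ then a s * b t else 0#) ≈ a s * (b t * translate s (indicator v) (toList t))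
    term s t = sym (begin
      a s * (b t * translate s (indicator v) (toList t))
        ≈⟨ *-assoc _ _ _ ⟨
      (a s * b t) * translate s (indicator v) (toList t)
        ≈⟨ *-if _ _ 1# ⟩
      (if ⌊ Listₚ.≡-dec _≟ᶠ_ (map (lookup s) (toList t)) (toList v) ⌋ then (a s * b t) * 1# else 0#)
        ≈⟨ if-cong _ (*-identityʳ _) ⟩
      (if ⌊ Listₚ.≡-dec _≟ᶠ_ (map (lookup s) (toList t)) (toList v) ⌋ then a s * b t else 0#)
        ≈⟨ reflexive (cong (λ b′ → if b′ then a s * b t else 0#) (reflects-⇔
             (isYes-reflects (Listₚ.≡-dec _≟ᶠ_ (map (lookup s) (toList t)) (toList v)))
             (isYes-reflects (Vecₚ.≡-dec _≟ᶠ_ (compose s t) v))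
             (λ e → toList-injective (≡.trans (toList-compose s t) e))
             (λ e → ≡.trans (≡.sym (toList-compose s t)) (cong toList e)))) ⟩
      (if ⌊ Vecₚ.≡-dec _≟ᶠ_ (compose s t) v ⌋ then a s * b t else 0#) ∎)

  -- The operators are abstract because this is used twice, for B_γ w₀ with `Z` itself and for w₀
  -- B_γ with its conjugate under reversal.
  module _ (n : ℕ) (y : KS n) (Z : Fn n → Fn n) (P : List Carrier → Fn n → Fn n)
    (⟨y⟩ : ∀ ψ → ⟨ y , ψ ⟩ ≈ Z ψ (allFin n))
    (P-[] : ∀ ψ → P [] ψ (allFin n) ≈ ψ (allFin n))
    (P-∷ : ∀ k ks ψ → P (k ∷ ks) ψ (allFin n) ≈ Z (P ks ψ) (allFin n) + - k * P ks ψ (allFin n))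
    (P-translate : ∀ ks t → IsInjective t → ∀ ψ → P ks (translate t ψ) (allFin n) ≈ P ks ψ (map (lookup t) (allFin n)))
    where
    open RingProperties ring using (-‿distribˡ-*)

    ⟨unit⟩ : ∀ ψ → ⟨ unit , ψ ⟩ ≈ ψ (allFin n)
    ⟨unit⟩ ψ = trans (⟨δ⟩ (tabulate id) (id-injective n) ψ) (reflexive (cong ψ (toList-tabulate id)))

    ⟨prodMinus⟩ : ∀ ks ψ → ⟨ prodMinus y ks , ψ ⟩ ≈ P ks ψ (allFin n)
    ⟨prodMinus⟩ []       ψ = trans (⟨unit⟩ ψ) (sym (P-[] ψ))
    ⟨prodMinus⟩ (k ∷ ks) ψ = begin
      ⟨ prodMinus y (k ∷ ks) , ψ ⟩
        ≈⟨ ⟨⊗⟩ (y ⊕ (⊝ (k ⊙ unit))) (prodMinus y ks) ψ ⟩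
      Σ[ perms n ] (λ t → (y t + - (k * unit t)) * ⟨ prodMinus y ks , translate t ψ ⟩)
        -- The hypothesis `P-translate` moves `t` from the test function to the word, so the inner
        -- pairing becomes the value of the single function `φ` at the word of `t`.
        ≈⟨ Σ-cong-∈ (perms n) (λ {t} t∈ → *-congˡ (trans (⟨prodMinus⟩ ks (translate t ψ))
             (trans (P-translate ks t (∈-perms⁻ t∈) ψ) (reflexive (cong (P ks ψ) (≡.sym (toList-lookup t))))))) ⟩
      Σ[ perms n ] (λ t → (y t + - (k * unit t)) * φ (toList t))
        ≈⟨ Σ-cong (perms n) (λ t → trans (distribʳ _ _ _) (+-congˡ (trans (*-congʳ (-‿distribˡ-* k (unit t))) (*-assoc _ _ _)))) ⟩
      Σ[ perms n ] (λ t → y t * φ (toList t) + - k * (unit t * φ (toList t)))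
        ≈⟨ Σ-+ (perms n) _ _ ⟩
      ⟨ y , φ ⟩ + Σ[ perms n ] (λ t → - k * (unit t * φ (toList t)))
        ≈⟨ +-cong (⟨y⟩ φ) (trans (Σ-*ˡ (perms n) (- k) _) (*-congˡ (⟨unit⟩ φ))) ⟩
      Z φ (allFin n) + - k * φ (allFin n)
        ≈⟨ P-∷ k ks ψ ⟨
      P (k ∷ ks) ψ (allFin n) ∎
      where
      φ = P ks ψ

    -- For a nonempty list the element is a product, so `⊗-coefficient` reads off its value at every
    -- vector, including vectors that are not permutations.
    prodMinus-∷-zero : ∀ k ks → (∀ ψ → P (k ∷ ks) ψ (allFin n) ≈ 0#) → IsZero (prodMinus y (k ∷ ks))
    prodMinus-∷-zero k ks e v = trans (⊗-coefficient _ _ v) (trans (⟨prodMinus⟩ (k ∷ ks) (indicator v)) (e (indicator v)))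

  module _ (n : ℕ) (γ : List ℕ → Carrier) where

    -- A sum over compositions instead of `γ (typeOf G)`, so that `⟨Bγ⟩` and `ñγ≈` come down to
    -- exchanging it with the sum over set compositions.
    weight : SetCompCode n → Carrier
    weight G = Σ[ compositions n ] (λ α → if typeIs α G then γ α else 0#)

    ⟨Bγ⟩ : ∀ ψ → ⟨ Bγ γ , ψ ⟩ ≈ Σ[ setComps n ] (λ G → weight G * ψ (T G (allFin n)))
    ⟨Bγ⟩ ψ = begin
      Σ[ perms n ] (λ t → Σ[ compositions n ] (λ α → γ α * Bα α t) * ψ (toList t))
        ≈⟨ Σ-cong (perms n) (λ t → trans (sym (Σ-*ʳ (compositions n) _ _)) (Σ-cong (compositions n) (λ α → *-assoc _ _ _))) ⟩
      Σ[ perms n ] (λ t → Σ[ compositions n ] (λ α → γ α * (Bα α t * ψ (toList t))))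
        ≈⟨ Σ-swap (perms n) (compositions n) _ ⟩
      Σ[ compositions n ] (λ α → Σ[ perms n ] (λ t → γ α * (Bα α t * ψ (toList t))))
        ≈⟨ Σ-cong (compositions n) (λ α → Σ-*ˡ (perms n) (γ α) _) ⟩
      Σ[ compositions n ] (λ α → γ α * ⟨ Bα α , ψ ⟩)
        ≈⟨ Σ-cong-∈ (compositions n) (λ {α} α∈ → *-congˡ (trans (⟨Bα⟩ α) (Σ-descents α∈ ψ))) ⟩
      Σ[ compositions n ] (λ α → γ α * Σ[ setComps n ] (λ G → if typeIs α G then ψ (T G (allFin n)) else 0#))
        ≈⟨ Σ-cong (compositions n) (λ α → sym (Σ-*ˡ (setComps n) (γ α) _)) ⟩
      Σ[ compositions n ] (λ α → Σ[ setComps n ] (λ G → γ α * (if typeIs α G then ψ (T G (allFin n)) else 0#)))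
        ≈⟨ Σ-swap (compositions n) (setComps n) _ ⟩
      Σ[ setComps n ] (λ G → Σ[ compositions n ] (λ α → γ α * (if typeIs α G then ψ (T G (allFin n)) else 0#)))
        ≈⟨ Σ-cong (setComps n) (λ G → trans (Σ-cong (compositions n) (λ α → trans (*-if (typeIs α G) _ _) (sym (if-* (typeIs α G) _ _)))) (Σ-*ʳ (compositions n) _ _)) ⟩
      Σ[ setComps n ] (λ G → weight G * ψ (T G (allFin n))) ∎
      where
      ⟨Bα⟩ : ∀ α → ⟨ Bα α , ψ ⟩ ≈ Σ[ perms n ] (λ v → if desSubB v α then ψ (toList v) else 0#)
      ⟨Bα⟩ α = begin
        Σ[ perms n ] (λ t → Σ[ perms n ] (λ v → if desSubB v α then δ v t else 0#) * ψ (toList t))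
          ≈⟨ Σ-cong (perms n) (λ t → sym (Σ-*ʳ (perms n) _ _)) ⟩
        Σ[ perms n ] (λ t → Σ[ perms n ] (λ v → (if desSubB v α then δ v t else 0#) * ψ (toList t)))
          ≈⟨ Σ-swap (perms n) (perms n) _ ⟩
        Σ[ perms n ] (λ v → Σ[ perms n ] (λ t → (if desSubB v α then δ v t else 0#) * ψ (toList t)))
          ≈⟨ Σ-cong-∈ (perms n) (λ {v} v∈ → branch v (∈-perms⁻ v∈)) ⟩
        Σ[ perms n ] (λ v → if desSubB v α then ψ (toList v) else 0#) ∎
        where
        branch : ∀ v → IsInjective v → Σ[ perms n ] (λ t → (if desSubB v α then δ v t else 0#) * ψ (toList t)) ≈
                                       (if desSubB v α then ψ (toList v) else 0#)
        branch v inj with desSubB v α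
        ... | true  = ⟨δ⟩ v inj ψ
        ... | false = Σ-0 (perms n) (λ _ → zeroˡ _)

    ⟨Bγ⊗w₀⟩ : ∀ ψ → ⟨ Bγ γ ⊗ δ (w₀ n) , ψ ⟩ ≈ Σ[ setComps n ] (λ G → weight G * ψ (reverse (T G (allFin n))))
    ⟨Bγ⊗w₀⟩ ψ = begin
      ⟨ Bγ γ ⊗ δ (w₀ n) , ψ ⟩
        ≈⟨ ⟨⊗⟩ (Bγ γ) (δ (w₀ n)) ψ ⟩
      Σ[ perms n ] (λ t → Bγ γ t * ⟨ δ (w₀ n) , translate t ψ ⟩)
        ≈⟨ Σ-cong (perms n) (λ t → *-congˡ (trans (⟨δ⟩ (w₀ n) (w₀-injective n) (translate t ψ)) (reflexive (cong ψ (reversed t))))) ⟩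
      ⟨ Bγ γ , ψ ∘ reverse ⟩
        ≈⟨ ⟨Bγ⟩ (ψ ∘ reverse) ⟩
      Σ[ setComps n ] (λ G → weight G * ψ (reverse (T G (allFin n)))) ∎
      where
      reversed : ∀ t → map (lookup t) (toList (w₀ n)) ≡ reverse (toList t)
      reversed t = ≡.trans (cong (map (lookup t)) (toList-w₀ n)) (≡.trans (Listₚ.reverse-map (lookup t) (allFin n)) (cong reverse (≡.sym (toList-lookup t))))

    open SignSums R using (Σ-relabel)

    -- Relabelling by `t` permutes the set compositions and preserves types, hence weights.
    X-translate : (t : Perm n) → IsInjective t → ∀ (ψ : Fn n) C →
                  Σ[ setComps n ] (λ G → weight G * translate t ψ (T G C)) ≈
                  Σ[ setComps n ] (λ G → weight G * ψ (T G (map (lookup t) C)))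
    X-translate t inj ψ C = begin
      Σ[ setComps n ] (λ G → weight G * translate t ψ (T G C))
        ≈⟨ Σ-relabel t inj (λ G → weight G * translate t ψ (T G C)) ⟨
      Σ[ setComps n ] (λ G → weight (relabel t G) * translate t ψ (T (relabel t G) C))
        ≈⟨ Σ-cong (setComps n) (λ G → *-cong
             (Σ-cong (compositions n) (λ α → reflexive (cong (λ β → if ⌊ Listₚ.≡-dec ℕ._≟_ β α ⌋ then γ α else 0#) (typeOf-relabel t inj G))))
             (reflexive (cong ψ (≡.sym (T-relabel t G C))))) ⟩
      Σ[ setComps n ] (λ G → weight G * ψ (T G (map (lookup t) C))) ∎

    ⟨w₀⊗Bγ⟩ : ∀ ψ → ⟨ δ (w₀ n) ⊗ Bγ γ , ψ ⟩ ≈ Σ[ setComps n ] (λ G → weight G * ψ (T G (reverse (allFin n))))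
    ⟨w₀⊗Bγ⟩ ψ = begin
      ⟨ δ (w₀ n) ⊗ Bγ γ , ψ ⟩
        ≈⟨ ⟨⊗⟩ (δ (w₀ n)) (Bγ γ) ψ ⟩
      Σ[ perms n ] (λ t → δ (w₀ n) t * ⟨ Bγ γ , translate t ψ ⟩)
        ≈⟨ Σ-cong-∈ (perms n) (λ {t} t∈ → *-congˡ (trans (⟨Bγ⟩ (translate t ψ)) (trans (X-translate t (∈-perms⁻ t∈) ψ (allFin n))
             (reflexive (cong Xψ (≡.sym (toList-lookup t))))))) ⟩
      ⟨ δ (w₀ n) , Xψ ⟩
        ≈⟨ ⟨δ⟩ (w₀ n) (w₀-injective n) Xψ ⟩
      Xψ (toList (w₀ n))
        ≈⟨ reflexive (cong Xψ (toList-w₀ n)) ⟩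
      Σ[ setComps n ] (λ G → weight G * ψ (T G (reverse (allFin n)))) ∎
      where
      Xψ : Fn n
      Xψ C = Σ[ setComps n ] (λ G → weight G * ψ (T G C))

    fromℕ-length-filter : {A : Set} (b : A → Bool) (xs : List A) →
                          fromℕ (length (filter (λ x → b x ≟B true) xs)) ≈ Σ[ xs ] (λ x → if b x then 1# else 0#)
    fromℕ-length-filter b []       = refl
    fromℕ-length-filter b (x ∷ xs) with b x
    ... | true  = +-congˡ (fromℕ-length-filter b xs)
    ... | false = trans (fromℕ-length-filter b xs) (sym (+-identityˡ _))

    -- Writing the count `nα` as a sum of indicators and exchanging it with the sum over α
    -- identifies the number in the theorem with the diagonal entry `eig F`.
    ñγ≈ : ∀ F → ñγ γ F ≈ sign (n ∸ len F) * Σ[ setComps n ] (λ G → if refinesB F G then weight G else 0#)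
    ñγ≈ F = begin
      Σ[ compositions n ] (λ α → γ α * (s * fromℕ (nα α F)))
        ≈⟨ Σ-cong (compositions n) (λ α → trans (*-swap (γ α) s _) (*-congˡ (trans
             (*-congˡ (fromℕ-length-filter (λ G → refinesB F G ∧ typeIs α G) (setComps n))) (sym (Σ-*ˡ (setComps n) (γ α) _))))) ⟩
      Σ[ compositions n ] (λ α → s * Σ[ setComps n ] (λ G → γ α * (if refinesB F G ∧ typeIs α G then 1# else 0#)))
        ≈⟨ Σ-*ˡ (compositions n) s _ ⟩
      s * Σ[ compositions n ] (λ α → Σ[ setComps n ] (λ G → γ α * (if refinesB F G ∧ typeIs α G then 1# else 0#)))
        ≈⟨ *-congˡ (Σ-swap (compositions n) (setComps n) _) ⟩
      s * Σ[ setComps n ] (λ G → Σ[ compositions n ] (λ α → γ α * (if refinesB F G ∧ typeIs α G then 1# else 0#)))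
        ≈⟨ *-congˡ (Σ-cong (setComps n) term) ⟩
      s * Σ[ setComps n ] (λ G → if refinesB F G then weight G else 0#) ∎
      where
      s = sign (n ∸ len F)
      term : ∀ G → Σ[ compositions n ] (λ α → γ α * (if refinesB F G ∧ typeIs α G then 1# else 0#)) ≈
                   (if refinesB F G then weight G else 0#)
      term G with refinesB F G
      ... | true  = Σ-cong (compositions n) (λ α → trans (*-if _ _ 1#) (if-cong _ (*-identityʳ _)))
      ... | false = Σ-0 (compositions n) (λ _ → zeroʳ _)

-- Both annihilating products in the group algebra

module Main {c ℓ ℓ₂} (K : OrderedCommRing c ℓ ℓ₂) (n : ℕ) where
  open OrderedCommRing K hiding (zero)
  open InRing commutativeRing
  open Pairing commutativeRing using (weight; translate; prodMinus-∷-zero; ⟨Bγ⊗w₀⟩; ⟨w₀⊗Bγ⟩; X-translate; ñγ≈)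
  open OrderedRing K using (≤-refl; Σ-nonneg)
  open SetoidMembership setoid using (_∈_)
  open SetoidUnique setoid using (Unique)

  unique-∈-dec : ∀ {ks} → Unique ks → ∀ {x y} → x ∈ ks → y ∈ ks → Dec (x ≈ y)
  unique-∈-dec u          (here p)  (here q)  = yes (trans p (sym q))
  unique-∈-dec (k∉ ∷ u) (here p)  (there q) = no λ e →
    SetoidMembershipₚ.∉-resp-≈ setoid (sym p) (Allₚ.All¬⇒¬Any k∉) (SetoidMembershipₚ.∈-resp-≈ setoid (sym e) q)
  unique-∈-dec (k∉ ∷ u) (there p) (here q)  = no λ e →
    SetoidMembershipₚ.∉-resp-≈ setoid (sym q) (Allₚ.All¬⇒¬Any k∉) (SetoidMembershipₚ.∈-resp-≈ setoid e p)
  unique-∈-dec (k∉ ∷ u) (there p) (there q) = unique-∈-dec u p q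

  module _ (γ : List ℕ → Carrier) (γ-nonneg : ∀ α → α ∈≡ compositions n → 0# ≤ γ α)
    (ks : List Carrier) (ks-unique : Unique ks) (ñγ∈ks : ∀ (F : SetCompCode n) → IsSetComp F → ñγ γ F ∈ ks) where

    weight-nonneg : ∀ G → 0# ≤ weight n γ G
    weight-nonneg G = Σ-nonneg (compositions n) (λ {α} α∈ → term α α∈)
      where
      term : ∀ α → α ∈≡ compositions n → 0# ≤ (if typeIs α G then γ α else 0#)
      term α α∈ with typeIs α G
      ... | true  = γ-nonneg α α∈
      ... | false = ≤-refl

    open Spectrum K n (weight n γ) weight-nonneg
    open Linear

    eig∈ks : ∀ F → IsSetComp F → eig F ∈ ks
    eig∈ks F s = SetoidMembershipₚ.∈-resp-≈ setoid (ñγ≈ n γ F) (ñγ∈ks F s)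

    open Annihilation (λ F H s s′ → unique-∈-dec ks-unique (eig∈ks F s) (eig∈ks H s′))

    -- Normalising the constant labelling gives the one-block set composition, or the empty one when
    -- n = 0, without a case distinction.
    module Top = Normalised (normalise {n} 1 (λ _ → zero))

    -- Sorting by `Top` is the identity, so every function has the form `ψ ∘T Top` and annihilation
    -- at `Top` is annihilation altogether.
    P-zero : ∀ ψ → P ks ψ ≋ 0ᶠ
    P-zero ψ C C-word = trans
      (cong-≋ (P-linear ks) (λ D _ → reflexive (cong ψ (≡.sym (≡.trans (Top.T-code D) (sort-trivial D))))) C C-word)
      (annihilation (suc (n ∸ len Top.code)) Top.code Top.isSetComp (ℕₚ.n<1+n _) ks (λ H s _ → eig∈ks H s) ψ C C-word)
      where
      sort-trivial : ∀ D → sort {n} {1} (λ _ → zero) D ≡ D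
      sort-trivial D = ≡.trans (Listₚ.++-identityʳ _) (filter-all (λ _ → zero {0} ≟ᶠ zero) (All.tabulate (λ _ → ≡.refl)))

    module _ (t : Perm n) (inj : IsInjective t) where

      Z-translate : ∀ ψ → Z (translate t ψ) ≋ translate t (Z ψ)
      Z-translate ψ C C-word = trans
        (cong-≋ X-linear (λ D _ → reflexive (cong ψ (Listₚ.reverse-map (lookup t) D))) C C-word)
        (X-translate n γ t inj (rev ψ) C)

      P-translate : ∀ ks ψ → P ks (translate t ψ) ≋ translate t (P ks ψ)
      P-translate []       ψ C C-word = refl
      P-translate (k ∷ ks) ψ C C-word = trans (cong-≋ (step-linear k) (P-translate ks ψ) C C-word)
        (+-congʳ (Z-translate (P ks ψ) C C-word))

    rev-involutive : ∀ φ → rev (rev φ) ≋ φ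
    rev-involutive φ C _ = reflexive (cong φ (Listₚ.reverse-involutive C))

    ks-nonempty : ∃ λ k → ∃ λ ks′ → ks ≡ k ∷ ks′
    ks-nonempty = nonempty (eig∈ks Top.code Top.isSetComp)
      where
      nonempty : ∀ {x l} → x ∈ l → ∃ λ k → ∃ λ ks′ → l ≡ k ∷ ks′
      nonempty {l = k ∷ ks′} _ = k , ks′ , ≡.refl

    allFin-word : IsWord (allFin n)
    allFin-word = ↭-refl

    prodMinus-Bγ⊗w₀ : IsZero (prodMinus (Bγ γ ⊗ δ (w₀ n)) ks)
    prodMinus-Bγ⊗w₀ with ks-nonempty
    ... | k , ks′ , e = subst (λ l → IsZero (prodMinus (Bγ γ ⊗ δ (w₀ n)) l)) (≡.sym e)
      (prodMinus-∷-zero n _ Z P (⟨Bγ⊗w₀⟩ n γ) (λ _ → refl) (λ _ _ _ → refl)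
        (λ l t inj ψ → P-translate t inj l ψ (allFin n) allFin-word) k ks′
        (λ ψ → subst (λ l → P l ψ (allFin n) ≈ 0#) e (P-zero ψ (allFin n) allFin-word)))

    prodMinus-w₀⊗Bγ : IsZero (prodMinus (δ (w₀ n) ⊗ Bγ γ) ks)
    prodMinus-w₀⊗Bγ with ks-nonempty
    ... | k , ks′ , e = subst (λ l → IsZero (prodMinus (δ (w₀ n) ⊗ Bγ γ) l)) (≡.sym e)
      -- As `Z φ` is `X (rev φ)`, conjugating `Z` by reversal leaves `rev ∘ X`, the operator of w₀
      -- B_γ; with this choice the recursion for the conjugated product holds by computation.
      (prodMinus-∷-zero n _ (rev ∘ X) (λ l → rev ∘ P l ∘ rev) (⟨w₀⊗Bγ⟩ n γ)
        (λ ψ → rev-involutive ψ (allFin n) allFin-word)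
        (λ _ _ _ → refl)
        (λ l t inj ψ → trans
          (cong-≋ (P-linear l) (λ D _ → reflexive (cong ψ (Listₚ.reverse-map (lookup t) D))) (reverse (allFin n)) reversed-word)
          (trans (P-translate t inj l (rev ψ) (reverse (allFin n)) reversed-word)
            (reflexive (cong (P l (rev ψ)) (Listₚ.reverse-map (lookup t) (allFin n))))))
        k ks′
        (λ ψ → subst (λ l → P l (rev ψ) (reverse (allFin n)) ≈ 0#) e (P-zero (rev ψ) (reverse (allFin n)) reversed-word)))
      where
      reversed-word : IsWord (reverse (allFin n))
      reversed-word = word-reverse allFin-word

theorem10p2 : ∀ {c ℓ ℓ₂} (K : OrderedCommRing c ℓ ℓ₂) (n : ℕ)
  → let open OrderedCommRing K
        open InRing commutativeRing
        open SetoidMembership setoid using (_∈_)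
        open SetoidUnique setoid using (Unique)
    in (γ : List ℕ → Carrier)
  → (∀ α → α ∈ℕ compositions n → 0# ≤ γ α)
  → (ks : List Carrier)
  → Unique ks
  → (∀ x → (x ∈ ks) ⇔ (∃ λ (F : SetCompCode n) → IsSetComp F × (x ≈ ñγ γ F)))
  → IsZero (prodMinus (δ (w₀ n) ⊗ Bγ γ) ks) × IsZero (prodMinus (Bγ γ ⊗ δ (w₀ n)) ks)
theorem10p2 K n γ γ-nonneg ks ks-unique spec =
  prodMinus-w₀⊗Bγ γ γ-nonneg ks ks-unique ñγ∈ks , prodMinus-Bγ⊗w₀ γ γ-nonneg ks ks-unique ñγ∈ks
  where
  open Main K n
  ñγ∈ks = λ F s → Equivalence.from (spec _) (F , s , OrderedCommRing.refl K)
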